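{- For every integer $n\ge2$, the Minkowski quotient of the bipermutahedron and the harmonic polytope is $\Pi_{n,n}/H_{n,n}=2$.
   Context: For polytopes $P,Q\subset\mathbb{R}^d$, the Minkowski quotient is $P/Q=\max\{\lambda\ge0:\ \lambda Q\text{ is a Minkowski summand of }P\}$, where $\lambda Q$ is a Minkowski summand of $P$ if $P=\lambda Q+R$ for some polytope $R$. The harmonic polytope is $H_{n,n}=\{(x,y)\in\mathbb{R}^n\times\mathbb{R}^n:\ \sum_ex_e=\sum_ey_e=\frac{n(n+1)}2+1,\ \sum_{s\in S}x_s+\sum_{t\in T}y_t\ge\frac{|S|(|S|+1)+|T|(|T|+1)}2+1\text{ for each bisubset }S|T\}$, where a bisubset of $[n]$ is an ordered pair $S|T$ of nonempty subsets with $S\cup T=[n]$, not both equal to $[n]$. The bipermutahedron: a bipermutation of $[n]$ is a sequence $\mathsf{B}=b_1|\cdots|b_{2n-1}$ of elements of $[n]$ in which one element $k$ appears exactly once and every other element exactly twice; form the length-$2n$ word replacing first and second occurrences of each $i\ne k$ by $i,\overline i$ and $k$ by $k\overline k$; let $\pi$ send the letters, left to right, to $-(2n-1),-(2n-3),\dots,-1,1,\dots,2n-1$; let $u=(x,y)$ with $x_i=\pi(i)$, $y_i=-\pi(\overline i)$, $s=\sum_ix_i$, and $v_{\mathsf{B}}=u-s(\mathsf{e}^k+\mathsf{f}^k)$ with $\mathsf{e}^k,\mathsf{f}^k$ the $k$-th standard basis vectors of the two factors. Then $\Pi_{n,n}=\mathrm{conv}\{v_{\mathsf{B}}:\mathsf{B}\text{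 a bipermutation of }[n]\}\subset\mathbb{R}^n\times\mathbb{R}^n$.
   Formalization: The polytopes are taken as sets of points with rational coordinates, and the scalars λ and the Minkowski summands R in the definition of the quotient are restricted to rational λ and convex hulls of finitely many rational points. -}

module Defs where

open import Data.Nat as ℕ using (ℕ; zero; suc)
open import Data.Integer as ℤ using (ℤ; +_)
open import Data.Rational as ℚ using (ℚ; 0ℚ; 1ℚ; ½; _≤_; _<_)
open import Data.Fin using (Fin; zero; suc)
open import Data.Fin.Subset using (Subset; ⊤; _∪_; ∣_∣; Nonempty)
open import Data.Vec using (lookup)
open import Data.Sum using (_⊎_; inj₁; inj₂)
open import Data.Product using (Σ; ∃; ∃-syntax; _×_; _,_)
open import Data.List using (List; []; _∷_; length; _++_)
open import Data.Bool using (Bool; true; false; if_then_else_; _∧_) renaming (_≟_ to _Bool≟_)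
open import Relation.Nullary using (¬_; does)
open import Relation.Binary.PropositionalEquality using (_≡_; _≢_)
open import Data.Fin using (_≟_)

Point : Set → Set
Point I = I → ℚ

_≐_ : {I : Set} → Point I → Point I → Set
p ≐ q = ∀ i → p i ≡ q i

PSet : Set → Set₁
PSet I = Point I → Set

_≅ₛ_ : {I : Set} → PSet I → PSet I → Set
S ≅ₛ T = ∀ x → (S x → T x) × (T x → S x)

Σℚ : (m : ℕ) → (Fin m → ℚ) → ℚ
Σℚ zero    f = 0ℚ
Σℚ (suc m) f = f zero ℚ.+ Σℚ m (λ j → f (suc j))

IsConvComb : {I : Set} (m : ℕ) → (Fin m → Point I) → Point I → Set
IsConvComb {I} m p x =
  Σ (Fin m → ℚ) λ w →
    (∀ j → 0ℚ ≤ w j) × (Σℚ m w ≡ 1ℚ) × (∀ i → x i ≡ Σℚ m (λ j → w j ℚ.* p j i))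

conv : {I : Set} → PSet I → PSet I
conv V x = ∃[ m ] Σ (Fin _ → _) λ p → (∀ j → V (p j)) × IsConvComb m p x

image : {I : Set} {m : ℕ} → (Fin m → Point I) → PSet I
image q y = ∃[ j ] (y ≐ q j)

_⊕_ : {I : Set} → PSet I → PSet I → PSet I
(S ⊕ T) x = ∃[ s ] ∃[ t ] (S s × T t × (∀ i → x i ≡ s i ℚ.+ t i))

_·ₛ_ : {I : Set} → ℚ → PSet I → PSet I
(λ' ·ₛ S) x = ∃[ s ] (S s × (∀ i → x i ≡ λ' ℚ.* s i))

IsMinkowskiSummand : {I : Set} → ℚ → PSet I → PSet I → Set
IsMinkowskiSummand λ' Q P =
  ∃[ m ] Σ (Fin m → Point _) λ r → P ≅ₛ ((λ' ·ₛ Q) ⊕ conv (image r))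

MinkowskiQuotientIs : {I : Set} → PSet I → PSet I → ℚ → Set
MinkowskiQuotientIs P Q μ =
  (0ℚ ≤ μ) × IsMinkowskiSummand μ Q P ×
  (∀ λ' → 0ℚ ≤ λ' → IsMinkowskiSummand λ' Q P → λ' ≤ μ)

-- ℝ^n × ℝ^n : coordinates indexed by Fin n ⊎ Fin n
-- x_e = p (inj₁ e),  y_e = p (inj₂ e)

Coord : ℕ → Set
Coord n = Fin n ⊎ Fin n

ℕ→ℚ : ℕ → ℚ
ℕ→ℚ k = + k ℚ./ 1

ℤ→ℚ : ℤ → ℚ
ℤ→ℚ z = z ℚ./ 1

sumOver : {n : ℕ} → Subset n → (Fin n → ℚ) → ℚ
sumOver {n} S f = Σℚ n (λ e → if lookup S e then f e else 0ℚ)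

IsBisubset : {n : ℕ} → Subset n → Subset n → Set
IsBisubset S T = Nonempty S × Nonempty T × (S ∪ T ≡ ⊤) × ¬ (S ≡ ⊤ × T ≡ ⊤)

Harmonic : (n : ℕ) → PSet (Coord n)
Harmonic n p =
  (Σℚ n (λ e → p (inj₁ e)) ≡ c) × (Σℚ n (λ e → p (inj₂ e)) ≡ c) ×
  (∀ (S T : Subset n) → IsBisubset S T →
     ((ℕ→ℚ (∣ S ∣ ℕ.* (∣ S ∣ ℕ.+ 1) ℕ.+ ∣ T ∣ ℕ.* (∣ T ∣ ℕ.+ 1))) ℚ.* ½ ℚ.+ 1ℚ)
       ≤ (sumOver S (λ s → p (inj₁ s)) ℚ.+ sumOver T (λ t → p (inj₂ t))))
  where
  c : ℚ
  c = ℕ→ℚ (n ℕ.* (n ℕ.+ 1)) ℚ.* ½ ℚ.+ 1ℚ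

count : {n : ℕ} → Fin n → List (Fin n) → ℕ
count i []       = 0
count i (b ∷ bs) = if does (i ≟ b) then suc (count i bs) else count i bs

IsBipermutation : (n : ℕ) → List (Fin n) → Fin n → Set
IsBipermutation n b k =
  (length b ≡ 2 ℕ.* n ℕ.∸ 1) × (count k b ≡ 1) × (∀ i → i ≢ k → count i b ≡ 2)

-- Letters of the length-2n word: (i , false) = i,  (i , true) = ī.
-- `seen` lists the elements already met once.
memb : {n : ℕ} → Fin n → List (Fin n) → Bool
memb i []       = false
memb i (b ∷ bs) = if does (i ≟ b) then true else memb i bs

wordFrom : {n : ℕ} → Fin n → List (Fin n) → List (Fin n) → List (Fin n × Bool)
wordFrom k seen []       = []
wordFrom k seen (b ∷ bs) =
  if does (b ≟ k) then (k , false) ∷ (k , true) ∷ wordFrom k seen bs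
  else (if memb b seen then (b , true) ∷ wordFrom k seen bs
        else (b , false) ∷ wordFrom k (b ∷ seen) bs)

word : {n : ℕ} → Fin n → List (Fin n) → List (Fin n × Bool)
word k b = wordFrom k [] b

position : {n : ℕ} → Fin n × Bool → List (Fin n × Bool) → ℕ
position l [] = 0
position (i , β) ((j , γ) ∷ w) =
  if does (i ≟ j) ∧ does (β Bool≟ γ) then 0 else suc (position (i , β) w)

-- π : letter at position p ↦ 2p + 1 − 2n  (i.e. −(2n−1), −(2n−3), …, −1, 1, …, 2n−1)
πval : (n : ℕ) → ℕ → ℚ
πval n p = ℤ→ℚ (+ (2 ℕ.* p ℕ.+ 1) ℤ.- + (2 ℕ.* n))

uvec : (n : ℕ) → List (Fin n) → Fin n → Point (Coord n)
uvec n b k (inj₁ i) = πval n (position (i , false) (word k b))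
uvec n b k (inj₂ i) = ℚ.- πval n (position (i , true) (word k b))

vertex : (n : ℕ) → List (Fin n) → Fin n → Point (Coord n)
vertex n b k c = uvec n b k c ℚ.- (if isk c then s else 0ℚ)
  where
  s : ℚ
  s = Σℚ n (λ i → uvec n b k (inj₁ i))
  isk : Coord n → Bool
  isk (inj₁ i) = does (i ≟ k)
  isk (inj₂ i) = does (i ≟ k)

BipermVertices : (n : ℕ) → PSet (Coord n)
BipermVertices n p = ∃[ b ] ∃[ k ] (IsBipermutation n b k × p ≐ vertex n b k)

Bipermutahedron : (n : ℕ) → PSet (Coord n)
Bipermutahedron n = conv (BipermVertices n)

{-# OPTIONS --safe #-}

-- The identity behind the theorem is Π = 2H + R with an explicit R. For a bipermutation B with unrepeated
-- element k, the vertex v_B equals 2 h_B + r_B. Here h_B ∈ H is e_k + f_k plus the ranks of the first occurrences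
-- (from the left) and of the second occurrences (from the right), and r_B counts, up to constants, the pairs in
-- which the second occurrence of j precedes the first occurrence of i; R is the convex hull of the r_B.
-- This gives Π ⊆ 2H + R at once. For the converse, Farkas' lemma reduces the claim to linear functionals ℓ:
-- sorting the letters by the values ℓ(x_i) and m − ℓ(y_i), with m = min_i (ℓ(x_i) + ℓ(y_i)), yields a
-- bipermutation C for which ℓ is minimal at h_C on H (Abel summation over the bisubset inequalities) and at r_C
-- among all r_B (a termwise comparison). For the upper bound take two coordinates of which R attains both minima
-- at one point, while on H each is at least 1 but their sum is at least 3; comparing 2H + R with μH + R' on them
-- gives μ ≤ 2.
module Submission where

open import Defs
open import Data.Nat as ℕ using (ℕ; zero; suc; z≤n; s≤s)
import Data.Nat.Properties as ℕ
import Data.Integer as ℤ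
import Data.Integer.Properties as ℤ
open import Data.Rational hiding (∣_∣)
open import Data.Rational.Properties
import Data.Rational.Unnormalised as ℚᵘ
import Data.Rational.Unnormalised.Properties as ℚᵘ
open import Data.Bool using (Bool; true; false; if_then_else_; _∧_) renaming (_≟_ to _Bool≟_)
import Data.Bool.Properties as Bool
open import Data.Empty using (⊥-elim)
open import Data.Maybe using (Maybe; just; nothing)
open import Data.Product using (Σ; ∃-syntax; _×_; _,_; proj₁; proj₂)
open import Data.Product.Relation.Binary.Lex.NonStrict using (×-decTotalOrder)
open import Data.Sum using (_⊎_; inj₁; inj₂)
open import Data.Sum.Properties using (inj₁-injective; inj₂-injective)
open import Data.Fin as Fin using (Fin; zero; suc; toℕ; punchIn; punchOut)
import Data.Fin.Properties as Fin
open import Data.Fin.Subset using (Subset; ⊤; ⊥; _∪_; ∣_∣; Nonempty; _∈_)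
open import Data.Fin.Subset.Properties using (∈⊤; ∣⊤∣≡n; ∣⊥∣≡0; ⊆-antisym; ⊆⊤; x∈p∪q⁻; x∈p∪q⁺)
open import Data.Vec using ([]; _∷_; here; there; lookup; tabulate)
open import Data.Vec.Properties using ([]=⇒lookup; lookup⇒[]=; lookup∘tabulate; lookup-replicate)
open import Data.List as List using (List; []; _∷_; length; _++_; map; allFin; cartesianProduct; cartesianProductWith; filter)
open import Data.List.Properties using (map-++; map-tabulate; length-++; length-tabulate; length-map)
open import Data.List.Membership.Propositional using () renaming (_∈_ to _∈ₗ_)
open import Data.List.Membership.Propositional.Properties
  using (∈-tabulate⁺; ∈-tabulate⁻; ∈-++⁺ˡ; ∈-++⁻; ∈-allFin; ∈-cartesianProduct⁺; ∈-cartesianProductWith⁺; ∈-filter⁺; ∈-filter⁻; ∈-lookup)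
open import Data.List.Relation.Unary.All as All using (All; []; _∷_)
open import Data.List.Relation.Unary.AllPairs as AllPairs using (AllPairs; []; _∷_)
open import Data.List.Relation.Unary.Any as Any using (here; there)
open import Data.List.Relation.Unary.Any.Properties using (lookup-index)
open import Data.List.Relation.Unary.Unique.Propositional using (Unique)
import Data.List.Relation.Unary.Unique.Propositional.Properties as Unique
open import Data.List.Relation.Unary.Sorted.TotalOrder.Properties using (Sorted⇒AllPairs)
open import Data.List.Relation.Binary.Permutation.Propositional as Perm using (_↭_; ↭-sym; ↭⇒↭ₛ)
import Data.List.Relation.Binary.Permutation.Propositional.Properties as Perm
import Data.List.Relation.Binary.Permutation.Setoid.Properties as SetoidPerm
import Data.List.Sort as Sort
open import Function using (_∋_; _∘_; id)
open import Relation.Binary.Bundles using (DecTotalOrder)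
import Relation.Binary.Construct.Flip.Ord as Flip
import Relation.Binary.Construct.On as On
open import Relation.Binary.Definitions using (tri<; tri≈; tri>)
open import Relation.Nullary using (¬_; Dec; yes; no; does)
open import Relation.Nullary.Decidable using (dec-true; dec-false; _×-dec_; _→-dec_; ¬?)
open import Relation.Binary.PropositionalEquality
open import Tactic.RingSolver using (solve-∀)
open import Tactic.RingSolver.Core.AlmostCommutativeRing using (AlmostCommutativeRing; fromCommutativeRing)

-- Rationals and finite sums

-- The element k carries the proof. The summand e_k + f_k of h_B supplies the 1 in every bisubset
-- inequality, because k lies in S or in T. It supplies 2 only for a cut between k and its bar,
-- where both sets contain k and h_B is not tight; but the choice of m gives these two letters equal
-- keys, so Abel summation weights such a cut by 0. The same m puts no bar above its own letter,
-- since ℓ(x_i) + ℓ(y_i) ≥ m, and makes the sign of ℓ(x_i) + ℓ(y_j) - m decide whether the bar of j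
-- may precede i. This is why the r_B can be compared pair by pair. The constants come from the
-- vertex: with c the number of pairs in which the bar of j precedes i, s = 2c - n², so subtracting
-- s(e_k + f_k) adds n² - 2c at k. Of this 2h_B takes 2 and r_B keeps n² - 2 - 2c. At most one of
-- (i,j) and (j,i) is such a pair, so 2c ≤ n² - n, and the remainder is nonnegative exactly because
-- n ≥ 2 gives n - 2 ≥ 0.

ℚ-ring : AlmostCommutativeRing _ _
ℚ-ring = fromCommutativeRing +-*-commutativeRing λ x → isZero (0ℚ ≟ x)
  where
  isZero : ∀ {x} → Dec (0ℚ ≡ x) → Maybe (0ℚ ≡ x)
  isZero (yes p) = just p
  isZero (no _)  = nothing

2ℚ : ℚ
2ℚ = ℤ.+ 2 / 1

0≤1 : 0ℚ ≤ 1ℚ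
0≤1 = nonNegative⁻¹ 1ℚ

0≤2 : 0ℚ ≤ 2ℚ
0≤2 = nonNegative⁻¹ 2ℚ

≤-by : ∀ {a b} e → 0ℚ ≤ e → b ≡ a + e → a ≤ b
≤-by {a} {b} e 0≤e eq = subst₂ _≤_ (+-identityʳ a) (sym eq) (+-monoʳ-≤ a 0≤e)

p≤q⇒0≤q-p : ∀ {p q} → p ≤ q → 0ℚ ≤ q - p
p≤q⇒0≤q-p {p} {q} p≤q = subst (_≤ q - p) (+-inverseʳ p) (+-monoˡ-≤ (- p) p≤q)

p≡q⇒p-q≡0 : ∀ {p q} → p ≡ q → p - q ≡ 0ℚ
p≡q⇒p-q≡0 {p} refl = +-inverseʳ p

*-nonneg : ∀ {p q} → 0ℚ ≤ p → 0ℚ ≤ q → 0ℚ ≤ p * q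
*-nonneg {p} {q} 0≤p 0≤q =
  nonNegative⁻¹ _ ⦃ nonNeg*nonNeg⇒nonNeg p ⦃ nonNegative 0≤p ⦄ q ⦃ nonNegative 0≤q ⦄ ⦄

+-nonneg : ∀ {p q} → 0ℚ ≤ p → 0ℚ ≤ q → 0ℚ ≤ p + q
+-nonneg = +-mono-≤

*-monoˡ-nonneg : ∀ {r p q} → 0ℚ ≤ r → p ≤ q → r * p ≤ r * q
*-monoˡ-nonneg {r} 0≤r = *-monoˡ-≤-nonNeg r ⦃ nonNegative 0≤r ⦄

halve-≤ : ∀ {p q} → 2ℚ * p ≤ 2ℚ * q → p ≤ q
halve-≤ = *-cancelˡ-≤-pos 2ℚ

square-nonneg : ∀ p → 0ℚ ≤ p * p
square-nonneg p with ≤-total 0ℚ p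
... | inj₁ 0≤p = *-nonneg 0≤p 0≤p
... | inj₂ p≤0 = subst (0ℚ ≤_) (((∀ p → (0ℚ - p) * (0ℚ - p) ≡ p * p) ∋ solve-∀ ℚ-ring) p)
  (*-nonneg (p≤q⇒0≤q-p p≤0) (p≤q⇒0≤q-p p≤0))

⟦_⟧ : ∀ {a} {P : Set a} → Dec P → ℚ
⟦ P? ⟧ = if does P? then 1ℚ else 0ℚ

⟦⟧-true : ∀ {a} {P : Set a} (P? : Dec P) → P → ⟦ P? ⟧ ≡ 1ℚ
⟦⟧-true P? p rewrite dec-true P? p = refl

⟦⟧-false : ∀ {a} {P : Set a} (P? : Dec P) → ¬ P → ⟦ P? ⟧ ≡ 0ℚ
⟦⟧-false P? ¬p rewrite dec-false P? ¬p = refl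

⟦⟧-nonneg : ∀ {a} {P : Set a} (P? : Dec P) → 0ℚ ≤ ⟦ P? ⟧
⟦⟧-nonneg (yes _) = 0≤1
⟦⟧-nonneg (no _)  = ≤-refl

⟦⟧-cong : ∀ {a b} {P : Set a} {Q : Set b} (P? : Dec P) (Q? : Dec Q) → (P → Q) → (Q → P) → ⟦ P? ⟧ ≡ ⟦ Q? ⟧
⟦⟧-cong (yes p) Q? f g = sym (⟦⟧-true Q? (f p))
⟦⟧-cong (no ¬p) Q? f g = sym (⟦⟧-false Q? (¬p ∘ g))

⟦⟧-exclusive : ∀ {a b} {P : Set a} {Q : Set b} (P? : Dec P) (Q? : Dec Q) → (P → ¬ Q) → ⟦ P? ⟧ + ⟦ Q? ⟧ ≤ 1ℚ
⟦⟧-exclusive (yes p) (yes q) ex = ⊥-elim (ex p q)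
⟦⟧-exclusive (yes _) (no _)  _  = ≤-refl
⟦⟧-exclusive (no _)  (yes _) _  = ≤-refl
⟦⟧-exclusive (no _)  (no _)  _  = 0≤1

δ : ∀ {n} → Fin n → Fin n → ℚ
δ i j = ⟦ i Fin.≟ j ⟧

δ-≢ : ∀ {n} {i j : Fin n} → i ≢ j → δ i j ≡ 0ℚ
δ-≢ {i = i} {j} = ⟦⟧-false (i Fin.≟ j)

δ-suc : ∀ {n} (i j : Fin n) → δ (suc i) (suc j) ≡ δ i j
δ-suc i j = ⟦⟧-cong (suc i Fin.≟ suc j) (i Fin.≟ j) Fin.suc-injective (cong suc)

-- Defined by recursion so that counting arguments go by induction; `ℕ→ℚ` passes through a
-- normalised fraction.
ι : ℕ → ℚ
ι zero    = 0ℚ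
ι (suc n) = 1ℚ + ι n

ι-nonneg : ∀ n → 0ℚ ≤ ι n
ι-nonneg zero    = ≤-refl
ι-nonneg (suc n) = +-nonneg 0≤1 (ι-nonneg n)

ι-+ : ∀ m n → ι (m ℕ.+ n) ≡ ι m + ι n
ι-+ zero    n = sym (+-identityˡ _)
ι-+ (suc m) n = trans (cong (1ℚ +_) (ι-+ m n)) (sym (+-assoc 1ℚ (ι m) (ι n)))

ι-* : ∀ m n → ι (m ℕ.* n) ≡ ι m * ι n
ι-* zero    n = sym (*-zeroˡ (ι n))
ι-* (suc m) n = trans (ι-+ n (m ℕ.* n)) (trans (cong (ι n +_) (ι-* m n))
  (((∀ a b → b + a * b ≡ (1ℚ + a) * b) ∋ solve-∀ ℚ-ring) (ι m) (ι n)))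

/1-+ : ∀ a b → (a ℤ.+ b) / 1 ≡ a / 1 + b / 1
/1-+ a b = toℚᵘ-injective (ℚᵘ.≃-trans (toℚᵘ-fromℚᵘ (ℚᵘ.mkℚᵘ (a ℤ.+ b) 0))
  (ℚᵘ.≃-trans lem (ℚᵘ.≃-sym (ℚᵘ.≃-trans (toℚᵘ-homo-+ (a / 1) (b / 1))
    (ℚᵘ.+-cong (toℚᵘ-fromℚᵘ (ℚᵘ.mkℚᵘ a 0)) (toℚᵘ-fromℚᵘ (ℚᵘ.mkℚᵘ b 0)))))))
  where
  lem : ℚᵘ.mkℚᵘ (a ℤ.+ b) 0 ℚᵘ.≃ ℚᵘ.mkℚᵘ a 0 ℚᵘ.+ ℚᵘ.mkℚᵘ b 0
  lem = ℚᵘ.*≡* (cong (ℤ._* ℤ.+ 1) (sym (cong₂ ℤ._+_ (ℤ.*-identityʳ a) (ℤ.*-identityʳ b))))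

ℕ→ℚ≡ι : ∀ n → ℕ→ℚ n ≡ ι n
ℕ→ℚ≡ι zero    = refl
ℕ→ℚ≡ι (suc n) = trans (/1-+ (ℤ.+ 1) (ℤ.+ n)) (cong (1ℚ +_) (ℕ→ℚ≡ι n))

/1-neg : ∀ a → (ℤ.- a) / 1 ≡ - (a / 1)
/1-neg a = trans (((∀ x y → x ≡ (x + y) - y) ∋ solve-∀ ℚ-ring) ((ℤ.- a) / 1) (a / 1))
  (trans (cong (_- a / 1) (trans (sym (/1-+ (ℤ.- a) a)) (cong (_/ 1) (ℤ.+-inverseˡ a)))) (+-identityˡ (- (a / 1))))

Σ-cong : ∀ {n} {f g : Fin n → ℚ} → (∀ i → f i ≡ g i) → Σℚ n f ≡ Σℚ n g
Σ-cong {zero}  eq = refl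
Σ-cong {suc n} eq = cong₂ _+_ (eq zero) (Σ-cong (eq ∘ suc))

Σ-+ : ∀ {n} (f g : Fin n → ℚ) → Σℚ n (λ i → f i + g i) ≡ Σℚ n f + Σℚ n g
Σ-+ {zero}  f g = refl
Σ-+ {suc n} f g = trans (cong ((f zero + g zero) +_) (Σ-+ (f ∘ suc) (g ∘ suc)))
  (((∀ a b c d → (a + b) + (c + d) ≡ (a + c) + (b + d)) ∋ solve-∀ ℚ-ring)
    (f zero) (g zero) (Σℚ n (f ∘ suc)) (Σℚ n (g ∘ suc)))

Σ-*ˡ : ∀ {n} c (f : Fin n → ℚ) → Σℚ n (λ i → c * f i) ≡ c * Σℚ n f
Σ-*ˡ {zero}  c f = sym (*-zeroʳ c)
Σ-*ˡ {suc n} c f = trans (cong ((c * f zero) +_) (Σ-*ˡ c (f ∘ suc))) (sym (*-distribˡ-+ c (f zero) (Σℚ n (f ∘ suc))))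

Σ-*ʳ : ∀ {n} c (f : Fin n → ℚ) → Σℚ n (λ i → f i * c) ≡ Σℚ n f * c
Σ-*ʳ c f = trans (Σ-cong (λ i → *-comm (f i) c)) (trans (Σ-*ˡ c f) (*-comm c (Σℚ _ f)))

Σ-- : ∀ {n} (f g : Fin n → ℚ) → Σℚ n (λ i → f i - g i) ≡ Σℚ n f - Σℚ n g
Σ-- {zero}  f g = refl
Σ-- {suc n} f g = trans (cong ((f zero - g zero) +_) (Σ-- (f ∘ suc) (g ∘ suc)))
  (((∀ a b c d → (a - b) + (c - d) ≡ (a + c) - (b + d)) ∋ solve-∀ ℚ-ring)
    (f zero) (g zero) (Σℚ n (f ∘ suc)) (Σℚ n (g ∘ suc)))

Σ-const : ∀ n c → Σℚ n (λ _ → c) ≡ ι n * c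
Σ-const zero    c = sym (*-zeroˡ c)
Σ-const (suc n) c = trans (cong (c +_) (Σ-const n c))
  (((∀ a c → c + a * c ≡ (1ℚ + a) * c) ∋ solve-∀ ℚ-ring) (ι n) c)

Σ-zero : ∀ {n} {f : Fin n → ℚ} → (∀ i → f i ≡ 0ℚ) → Σℚ n f ≡ 0ℚ
Σ-zero {n} eq = trans (Σ-cong eq) (trans (Σ-const n 0ℚ) (*-zeroʳ (ι n)))

Σ-one : ∀ n → Σℚ n (λ _ → 1ℚ) ≡ ι n
Σ-one n = trans (Σ-const n 1ℚ) (*-identityʳ (ι n))

Σ-nonneg : ∀ {n} {f : Fin n → ℚ} → (∀ i → 0ℚ ≤ f i) → 0ℚ ≤ Σℚ n f
Σ-nonneg {zero}  p = ≤-refl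
Σ-nonneg {suc n} p = +-nonneg (p zero) (Σ-nonneg (p ∘ suc))

Σ-mono : ∀ {n} {f g : Fin n → ℚ} → (∀ i → f i ≤ g i) → Σℚ n f ≤ Σℚ n g
Σ-mono {zero}  p = ≤-refl
Σ-mono {suc n} p = +-mono-≤ (p zero) (Σ-mono (p ∘ suc))

term≤Σ : ∀ {n} {f : Fin n → ℚ} → (∀ i → 0ℚ ≤ f i) → ∀ i → f i ≤ Σℚ n f
term≤Σ {suc n} {f} p zero    = ≤-by _ (Σ-nonneg (p ∘ suc)) refl
term≤Σ {suc n} {f} p (suc i) = ≤-trans (term≤Σ (p ∘ suc) i) (≤-by (f zero) (p zero) (+-comm (f zero) (Σℚ n (f ∘ suc))))

Σ-swap : ∀ m n (f : Fin m → Fin n → ℚ) →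
  Σℚ m (λ i → Σℚ n (f i)) ≡ Σℚ n (λ j → Σℚ m (λ i → f i j))
Σ-swap zero    n f = sym (Σ-zero {n} (λ _ → refl))
Σ-swap (suc m) n f = trans (cong (Σℚ n (f zero) +_) (Σ-swap m n (f ∘ suc)))
  (sym (Σ-+ (f zero) (λ j → Σℚ m (λ i → f (suc i) j))))

Σ-δ : ∀ {n} k (f : Fin n → ℚ) → Σℚ n (λ i → δ i k * f i) ≡ f k
Σ-δ {suc n} zero f = trans (cong₂ _+_ (*-identityˡ (f zero))
  (Σ-zero (λ i → trans (cong (_* f (suc i)) (δ-≢ {i = suc i} {zero} λ ())) (*-zeroˡ (f (suc i)))))) (+-identityʳ _)
Σ-δ {suc n} (suc k) f = trans (cong₂ _+_
  (trans (cong (_* f zero) (δ-≢ {i = zero} {suc k} λ ())) (*-zeroˡ (f zero)))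
  (trans (Σ-cong (λ i → cong (_* f (suc i)) (δ-suc i k))) (Σ-δ k (f ∘ suc)))) (+-identityˡ (f (suc k)))

Σ-δ1 : ∀ {n} (k : Fin n) → Σℚ n (λ i → δ i k) ≡ 1ℚ
Σ-δ1 {n} k = trans (Σ-cong (λ i → sym (*-identityʳ (δ i k)))) (Σ-δ k (λ _ → 1ℚ))

-- Farkas' lemma and convex hulls

-- Farkas' lemma is needed on `Coord n` and on `Coord n` with one homogenising coordinate added.
-- Abstracting the finite sum lets disjoint unions serve as index sets without being renumbered by a
-- `Fin`.
record Summation (I : Set) : Set where
  field
    ∑        : (I → ℚ) → ℚ
    ∑-cong   : ∀ {f g} → (∀ i → f i ≡ g i) → ∑ f ≡ ∑ g
    ∑-+      : ∀ f g → ∑ (λ i → f i + g i) ≡ ∑ f + ∑ g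
    ∑-*ˡ     : ∀ c f → ∑ (λ i → c * f i) ≡ c * ∑ f
    ∑-nonneg : ∀ {f} → (∀ i → 0ℚ ≤ f i) → 0ℚ ≤ ∑ f
    term≤∑   : ∀ {f} → (∀ i → 0ℚ ≤ f i) → ∀ i → f i ≤ ∑ f

  ∑-zero : ∑ (λ _ → 0ℚ) ≡ 0ℚ
  ∑-zero = trans (∑-cong (λ _ → sym (*-zeroˡ 0ℚ))) (trans (∑-*ˡ 0ℚ (λ _ → 0ℚ)) (*-zeroˡ (∑ (λ _ → 0ℚ))))

  infix 8 _∙_
  _∙_ : (I → ℚ) → (I → ℚ) → ℚ
  a ∙ x = ∑ (λ i → a i * x i)

  ∙-linʳ : ∀ a x c y → a ∙ (λ i → x i + c * y i) ≡ a ∙ x + c * a ∙ y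
  ∙-linʳ a x c y = trans
    (∑-cong (λ i → ((∀ a x c y → a * (x + c * y) ≡ a * x + c * (a * y)) ∋ solve-∀ ℚ-ring) (a i) (x i) c (y i)))
    (trans (∑-+ (λ i → a i * x i) (λ i → c * (a i * y i)))
           (cong (a ∙ x +_) (∑-*ˡ c (λ i → a i * y i))))

  ∙-linˡ : ∀ a c b x → (λ i → a i + c * b i) ∙ x ≡ a ∙ x + c * b ∙ x
  ∙-linˡ a c b x = trans (∑-cong (λ i → *-comm (a i + c * b i) (x i)))
    (trans (∙-linʳ x a c b) (cong₂ (λ u v → u + c * v) (∑-cong (λ i → *-comm (x i) (a i)))
      (∑-cong (λ i → *-comm (x i) (b i)))))

  ∙-Σ : ∀ m a (w : Fin m → ℚ) (x : Fin m → I → ℚ) →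
    a ∙ (λ i → Σℚ m (λ j → w j * x j i)) ≡ Σℚ m (λ j → w j * a ∙ x j)
  ∙-Σ zero    a w x = trans (∑-cong (λ i → *-zeroʳ (a i))) ∑-zero
  ∙-Σ (suc m) a w x = trans
    (∑-cong (λ i → ((∀ a w x s → a * (w * x + s) ≡ w * (a * x) + a * s) ∋ solve-∀ ℚ-ring)
      (a i) (w zero) (x zero i) (Σℚ m (λ j → w (suc j) * x (suc j) i))))
    (trans (∑-+ (λ i → w zero * (a i * x zero i)) (λ i → a i * Σℚ m (λ j → w (suc j) * x (suc j) i)))
      (cong₂ _+_ (∑-*ˡ (w zero) (λ i → a i * x zero i)) (∙-Σ m a (w ∘ suc) (x ∘ suc))))

finite : ∀ n → Summation (Fin n)
finite n = record
  { ∑ = Σℚ n ; ∑-cong = Σ-cong ; ∑-+ = Σ-+ ; ∑-*ˡ = Σ-*ˡ ; ∑-nonneg = Σ-nonneg ; term≤∑ = term≤Σ }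

_⊎ₛ_ : ∀ {I J} → Summation I → Summation J → Summation (I ⊎ J)
A ⊎ₛ B = record
  { ∑        = λ f → A.∑ (f ∘ inj₁) + B.∑ (f ∘ inj₂)
  ; ∑-cong   = λ eq → cong₂ _+_ (A.∑-cong (eq ∘ inj₁)) (B.∑-cong (eq ∘ inj₂))
  ; ∑-+      = λ f g → trans (cong₂ _+_ (A.∑-+ (f ∘ inj₁) (g ∘ inj₁)) (B.∑-+ (f ∘ inj₂) (g ∘ inj₂)))
      (((∀ a b c d → (a + b) + (c + d) ≡ (a + c) + (b + d)) ∋ solve-∀ ℚ-ring)
        (A.∑ (f ∘ inj₁)) (A.∑ (g ∘ inj₁)) (B.∑ (f ∘ inj₂)) (B.∑ (g ∘ inj₂)))
  ; ∑-*ˡ     = λ c f → trans (cong₂ _+_ (A.∑-*ˡ c (f ∘ inj₁)) (B.∑-*ˡ c (f ∘ inj₂)))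
      (sym (*-distribˡ-+ c (A.∑ (f ∘ inj₁)) (B.∑ (f ∘ inj₂))))
  ; ∑-nonneg = λ p → +-nonneg (A.∑-nonneg (p ∘ inj₁)) (B.∑-nonneg (p ∘ inj₂))
  ; term≤∑   = λ { {f} p (inj₁ i) → ≤-trans (A.term≤∑ (p ∘ inj₁) i) (≤-by (B.∑ (f ∘ inj₂)) (B.∑-nonneg (p ∘ inj₂)) refl)
                 ; {f} p (inj₂ j) → ≤-trans (B.term≤∑ (p ∘ inj₂) j)
                     (≤-by (A.∑ (f ∘ inj₁)) (A.∑-nonneg (p ∘ inj₁)) (+-comm (A.∑ (f ∘ inj₁)) (B.∑ (f ∘ inj₂)))) }
  }
  where
  module A = Summation A
  module B = Summation B

square-pos : ∀ {p} → p ≢ 0ℚ → 0ℚ < p * p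
square-pos {p} p≢0 with <-cmp p 0ℚ
... | tri< p<0 _ _ = positive⁻¹ _ ⦃ neg*neg⇒pos p ⦃ negative p<0 ⦄ p ⦃ negative p<0 ⦄ ⦄
... | tri≈ _ p≡0 _ = ⊥-elim (p≢0 p≡0)
... | tri> _ _ 0<p = positive⁻¹ _ ⦃ pos*pos⇒pos p ⦃ positive 0<p ⦄ p ⦃ positive 0<p ⦄ ⦄

module _ {I : Set} (S : Summation I) where
  open Summation S

  -- The index set cannot be searched, so the vanishing of γ is decided through the single number
  -- `γ ∙ γ`, which dominates every square.
  zero-or-pos : (γ : I → ℚ) → (∀ i → γ i ≡ 0ℚ) ⊎ 0ℚ < γ ∙ γ
  zero-or-pos γ with 0ℚ <? γ ∙ γ
  ... | yes 0<γγ = inj₂ 0<γγ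
  ... | no  γγ≤0 = inj₁ vanishes
    where
    vanishes : ∀ i → γ i ≡ 0ℚ
    vanishes i with γ i ≟ 0ℚ
    ... | yes eq = eq
    ... | no neq = ⊥-elim (γγ≤0 (<-≤-trans (square-pos neq) (term≤∑ (λ i → square-nonneg (γ i)) i)))

  -- Induction on the number of generators. If the separating x found for the others is negative on
  -- α₀, everything is projected along x and the induction hypothesis is applied once more, to m
  -- projected functionals.
  farkas : ∀ m (α : Fin m → I → ℚ) (γ : I → ℚ) →
    (Σ (Fin m → ℚ) λ w → (∀ j → 0ℚ ≤ w j) × (∀ i → γ i ≡ Σℚ m (λ j → w j * α j i)))
    ⊎ (Σ (I → ℚ) λ x → (∀ j → 0ℚ ≤ α j ∙ x) × γ ∙ x < 0ℚ)
  farkas zero α γ with zero-or-pos γ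
  ... | inj₁ γ≡0  = inj₁ ((λ ()) , (λ ()) , γ≡0)
  -- With no generators, -γ separates; it is written as 0 + (-1)γ to fit `∙-linʳ`.
  ... | inj₂ 0<γγ = inj₂ ((λ i → 0ℚ + (- 1ℚ) * γ i) , (λ ()) ,
    subst (_< 0ℚ) (sym (trans (∙-linʳ γ (λ _ → 0ℚ) (- 1ℚ) γ)
      (trans (cong (_+ (- 1ℚ) * γ ∙ γ) (trans (∑-cong (λ i → *-zeroʳ (γ i))) ∑-zero))
        (((∀ p → 0ℚ + (- 1ℚ) * p ≡ - p) ∋ solve-∀ ℚ-ring) (γ ∙ γ)))))
      (neg-antimono-< 0<γγ))
  farkas (suc m) α γ with farkas m (α ∘ suc) γ
  ... | inj₁ (w , w≥0 , eq) = inj₁ (w′ , w′≥0 , λ i → trans (eq i)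
          (((∀ a s → s ≡ 0ℚ * a + s) ∋ solve-∀ ℚ-ring) (α zero i) (Σℚ m (λ j → w j * α (suc j) i))))
    where
    w′ : Fin (suc m) → ℚ
    w′ zero    = 0ℚ
    w′ (suc j) = w j
    w′≥0 : ∀ j → 0ℚ ≤ w′ j
    w′≥0 zero    = ≤-refl
    w′≥0 (suc j) = w≥0 j
  ... | inj₂ (x , αx≥0 , γx<0) with 0ℚ ≤? α zero ∙ x
  ...   | yes α₀x≥0 = inj₂ (x , (λ { zero → α₀x≥0 ; (suc j) → αx≥0 j }) , γx<0)
  ...   | no  α₀x≱0 = shear (farkas m α′ γ′)
    where
    d : ℚ
    d = - (α zero ∙ x)
    d>0 : 0ℚ < d
    d>0 = neg-antimono-< (≰⇒> α₀x≱0)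
    instance
      d-nonZero : NonZero d
      d-nonZero = pos⇒nonZero d ⦃ positive d>0 ⦄
    e : ℚ
    e = 1/ d
    e≥0 : 0ℚ ≤ e
    e≥0 = <⇒≤ (positive⁻¹ e ⦃ 1/pos⇒pos d ⦃ positive d>0 ⦄ ⦄)
    -- The functionals composed with the projection along x onto the kernel of α₀.
    c : (I → ℚ) → ℚ
    c β = e * β ∙ x
    proj : (I → ℚ) → I → ℚ
    proj β i = β i + c β * α zero i
    α′ : Fin m → I → ℚ
    α′ j = proj (α (suc j))
    γ′ : I → ℚ
    γ′ = proj γ
    shear : _ → _
    shear (inj₁ (w , w≥0 , eq)) = inj₁ (w′ , w′≥0 , eq′)
      where
      -- The coefficient of α₀ that undoes the projection. Its sign is right because every other
      -- generator is nonnegative on x while γ is negative there.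
      w₀ : ℚ
      w₀ = Σℚ m (λ j → w j * c (α (suc j))) - c γ
      w′ : Fin (suc m) → ℚ
      w′ zero    = w₀
      w′ (suc j) = w j
      w′≥0 : ∀ j → 0ℚ ≤ w′ j
      w′≥0 zero    = +-nonneg (Σ-nonneg (λ j → *-nonneg (w≥0 j) (*-nonneg e≥0 (αx≥0 j))))
        (subst (0ℚ ≤_) (((∀ a b → a * (- b) ≡ - (a * b)) ∋ solve-∀ ℚ-ring) e (γ ∙ x))
          (*-nonneg e≥0 (<⇒≤ (neg-antimono-< γx<0))))
      w′≥0 (suc j) = w≥0 j
      eq′ : ∀ i → γ i ≡ w₀ * α zero i + Σℚ m (λ j → w j * α (suc j) i)
      eq′ i = begin
        γ i
          ≡⟨ ((∀ g t → g ≡ (g + t) - t) ∋ solve-∀ ℚ-ring) (γ i) (c γ * α zero i) ⟩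
        γ′ i - c γ * α zero i
          ≡⟨ cong (_- c γ * α zero i) (eq i) ⟩
        Σℚ m (λ j → w j * (α (suc j) i + c (α (suc j)) * α zero i)) - c γ * α zero i
          ≡⟨ cong (_- c γ * α zero i) (trans (Σ-cong (λ j →
               ((∀ w a k z → w * (a + k * z) ≡ w * a + (w * k) * z) ∋ solve-∀ ℚ-ring) (w j) (α (suc j) i)
                 (c (α (suc j))) (α zero i)))
               (trans (Σ-+ (λ j → w j * α (suc j) i) (λ j → (w j * c (α (suc j))) * α zero i))
                 (cong (Σℚ m (λ j → w j * α (suc j) i) +_) (Σ-*ʳ (α zero i) (λ j → w j * c (α (suc j))))))) ⟩
        (Σℚ m (λ j → w j * α (suc j) i) + Σℚ m (λ j → w j * c (α (suc j))) * α zero i) - c γ * α zero i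
          ≡⟨ ((∀ s t z g → (s + t * z) - g * z ≡ (t - g) * z + s) ∋ solve-∀ ℚ-ring)
               (Σℚ m (λ j → w j * α (suc j) i)) (Σℚ m (λ j → w j * c (α (suc j)))) (α zero i) (c γ) ⟩
        w₀ * α zero i + Σℚ m (λ j → w j * α (suc j) i) ∎
        where open ≡-Reasoning
    shear (inj₂ (y , α′y≥0 , γ′y<0)) = inj₂ (z , αz≥0 , subst (_< 0ℚ) (sym (∙z γ)) γ′y<0)
      where
      -- The projection of y along x: the multiple of x is chosen so that α₀ vanishes at z, and
      -- every β takes at z the value of `proj β` at y.
      z : I → ℚ
      z i = y i + (e * α zero ∙ y) * x i
      ∙z : ∀ β → β ∙ z ≡ proj β ∙ y
      ∙z β = trans (∙-linʳ β y (e * α zero ∙ y) x) (trans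
        (((∀ b e a bx → b + (e * a) * bx ≡ b + (e * bx) * a) ∋ solve-∀ ℚ-ring) (β ∙ y) e (α zero ∙ y) (β ∙ x))
        (sym (∙-linˡ β (c β) (α zero) y)))
      αz≥0 : ∀ j → 0ℚ ≤ α j ∙ z
      αz≥0 zero    = ≤-reflexive (sym (trans (∙-linʳ (α zero) y (e * α zero ∙ y) x) (trans
        (((∀ a e b → a + (e * a) * b ≡ a * (1ℚ - e * (- b))) ∋ solve-∀ ℚ-ring) (α zero ∙ y) e (α zero ∙ x))
        (trans (cong (λ t → α zero ∙ y * (1ℚ - t)) (*-inverseˡ d)) (*-zeroʳ (α zero ∙ y))))))
      αz≥0 (suc j) = subst (0ℚ ≤_) (sym (∙z (α (suc j)))) (α′y≥0 j)

module _ {I : Set} (S : Summation I) where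
  open Summation S

  -- The extra coordinate 1 turns convex combinations into conic ones, as it forces the weights to
  -- sum to 1. A separating vector would make its linear part strictly smaller at x than at every
  -- `p j`, against the hypothesis.
  conv-by-support : ∀ {m} (p : Fin m → Point I) (x : Point I) →
    (∀ ℓ → ∃[ j ] ℓ ∙ p j ≤ ℓ ∙ x) → IsConvComb m p x
  conv-by-support {m} p x support = certificate (farkas (finite 1 ⊎ₛ S) m (λ j → lift (p j)) (lift x))
    where
    lift : Point I → Point (Fin 1 ⊎ I)
    lift q (inj₁ _) = 1ℚ
    lift q (inj₂ i) = q i
    module L = Summation (finite 1 ⊎ₛ S)
    certificate :
      (Σ (Fin m → ℚ) λ w → (∀ j → 0ℚ ≤ w j) × (∀ i → lift x i ≡ Σℚ m (λ j → w j * lift (p j) i)))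
      ⊎ (Σ (Fin 1 ⊎ I → ℚ) λ y → (∀ j → 0ℚ ≤ lift (p j) L.∙ y) × lift x L.∙ y < 0ℚ) → IsConvComb m p x
    certificate (inj₁ (w , w≥0 , eq)) = w , w≥0 ,
      trans (Σ-cong (λ j → sym (*-identityʳ (w j)))) (sym (eq (inj₁ zero))) , (λ i → eq (inj₂ i))
    certificate (inj₂ (y , py≥0 , xy<0)) = ⊥-elim (<-irrefl refl (<-≤-trans xy<0 (≤-trans (py≥0 (proj₁ below))
      (+-monoʳ-≤ (1ℚ * y (inj₁ zero) + 0ℚ) (subst₂ _≤_ (∙-comm (p (proj₁ below))) (∙-comm x) (proj₂ below))))))
      where
      below : ∃[ j ] (y ∘ inj₂) ∙ p j ≤ (y ∘ inj₂) ∙ x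
      below = support (y ∘ inj₂)
      ∙-comm : ∀ q → (y ∘ inj₂) ∙ q ≡ q ∙ (y ∘ inj₂)
      ∙-comm q = ∑-cong (λ i → *-comm (y (inj₂ i)) (q i))

-- Words of bipermutations

Letter : ℕ → Set
Letter n = Fin n × Bool

letter : ∀ {n} → Coord n → Letter n
letter (inj₁ i) = i , false
letter (inj₂ i) = i , true

coords : ∀ n → Summation (Coord n)
coords n = finite n ⊎ₛ finite n

module _ {n : ℕ} where
  open Summation (coords n) public

occurrences : ∀ {n} → Letter n → List (Letter n) → ℕ
occurrences l       []            = 0
occurrences (i , β) ((j , γ) ∷ w) =
  if does (i Fin.≟ j) ∧ does (β Bool≟ γ) then suc (occurrences (i , β) w) else occurrences (i , β) w

position≤length : ∀ {n} (l : Letter n) w → position l w ℕ.≤ length w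
position≤length l [] = z≤n
position≤length (i , β) ((j , γ) ∷ w) with does (i Fin.≟ j) ∧ does (β Bool≟ γ)
... | true  = z≤n
... | false = s≤s (position≤length (i , β) w)

position-absent : ∀ {n} (l : Letter n) w → occurrences l w ≡ 0 → position l w ≡ length w
position-absent l [] _ = refl
position-absent (i , β) ((j , γ) ∷ w) absent with does (i Fin.≟ j) ∧ does (β Bool≟ γ)
... | false = cong suc (position-absent (i , β) w absent)

position-present : ∀ {n} (l : Letter n) w → 1 ℕ.≤ occurrences l w → position l w ℕ.< length w
position-present (i , β) ((j , γ) ∷ w) present with does (i Fin.≟ j) ∧ does (β Bool≟ γ)
... | true  = s≤s z≤n
... | false = s≤s (position-present (i , β) w present)

match⇒≡ : ∀ {n} (i j : Fin n) β γ → does (i Fin.≟ j) ∧ does (β Bool≟ γ) ≡ true → (i , β) ≡ (j , γ)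
match⇒≡ i j β γ eq with i Fin.≟ j | β Bool≟ γ
... | yes refl | yes refl = refl

position-injective : ∀ {n} (l l′ : Letter n) w → position l w ℕ.< length w → position l w ≡ position l′ w → l ≡ l′
position-injective (i , β) (i′ , β′) ((j , γ) ∷ w) (s≤s p) eq
  with does (i Fin.≟ j) ∧ does (β Bool≟ γ) in m | does (i′ Fin.≟ j) ∧ does (β′ Bool≟ γ) in m′
... | true  | true  = trans (match⇒≡ i j β γ m) (sym (match⇒≡ i′ j β′ γ m′))
... | false | false = position-injective (i , β) (i′ , β′) w p (ℕ.suc-injective eq)

letter-injective : ∀ {n} {c c′ : Coord n} → letter c ≡ letter c′ → c ≡ c′
letter-injective {c = inj₁ _} {inj₁ _} refl = refl
letter-injective {c = inj₂ _} {inj₂ _} refl = refl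

∑-match : ∀ {n} (j : Fin n) γ →
  ∑ (λ c → if does (proj₁ (letter c) Fin.≟ j) ∧ does (proj₂ (letter c) Bool≟ γ) then 1ℚ else 0ℚ) ≡ 1ℚ
∑-match {n} j γ with γ
... | false = trans (cong₂ _+_
  (trans (Σ-cong (λ i → cong (if_then 1ℚ else 0ℚ) (Bool.∧-identityʳ (does (i Fin.≟ j))))) (Σ-δ1 j))
  (Σ-zero (λ i → cong (if_then 1ℚ else 0ℚ) (Bool.∧-zeroʳ (does (i Fin.≟ j)))))) (+-identityʳ 1ℚ)
... | true = trans (cong₂ _+_
  (Σ-zero (λ i → cong (if_then 1ℚ else 0ℚ) (Bool.∧-zeroʳ (does (i Fin.≟ j)))))
  (trans (Σ-cong (λ i → cong (if_then 1ℚ else 0ℚ) (Bool.∧-identityʳ (does (i Fin.≟ j))))) (Σ-δ1 j))) (+-identityˡ 1ℚ)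

-- Every place below q holds exactly one letter: the head accounts for place 0, and all other places
-- shift down by one in the tail.
positions-below : ∀ {n} (w : List (Letter n)) → (∀ c → occurrences (letter c) w ℕ.≤ 1) →
  ∀ q → q ℕ.≤ length w → ∑ (λ c → ⟦ position (letter c) w ℕ.<? q ⟧) ≡ ι q
positions-below {n} w once zero q≤ = trans (∑-cong (λ c → ⟦⟧-false (position (letter c) w ℕ.<? 0) λ ()))
  (∑-zero {n = n})
positions-below ((j , γ) ∷ w) once (suc q) (s≤s q≤) = trans (∑-cong split)
  (trans (∑-+ (λ c → if does (proj₁ (letter c) Fin.≟ j) ∧ does (proj₂ (letter c) Bool≟ γ) then 1ℚ else 0ℚ)
    (λ c → ⟦ position (letter c) w ℕ.<? q ⟧))
    (cong₂ _+_ (∑-match j γ) (positions-below w once′ q q≤)))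
  where
  once′ : ∀ c → occurrences (letter c) w ℕ.≤ 1
  once′ c with does (proj₁ (letter c) Fin.≟ j) ∧ does (proj₂ (letter c) Bool≟ γ) | once c
  ... | true  | s≤s z = ℕ.≤-trans z z≤n
  ... | false | le    = le
  split : ∀ c → ⟦ position (letter c) ((j , γ) ∷ w) ℕ.<? suc q ⟧ ≡
    (if does (proj₁ (letter c) Fin.≟ j) ∧ does (proj₂ (letter c) Bool≟ γ) then 1ℚ else 0ℚ) + ⟦ position
      (letter c) w ℕ.<? q ⟧
  split c with does (proj₁ (letter c) Fin.≟ j) ∧ does (proj₂ (letter c) Bool≟ γ) | once c
  ... | false | _ = trans (⟦⟧-cong (suc (position (letter c) w) ℕ.<? suc q)
    (position (letter c) w ℕ.<? q) ℕ.s≤s⁻¹ s≤s) (sym (+-identityˡ ⟦ position (letter c) w ℕ.<? q ⟧))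
  -- The head letter does not recur in the tail, where `position` returns the length as default.
  -- This is at least q, so the letter is not counted twice.
  ... | true  | s≤s z = trans (⟦⟧-true (0 ℕ.<? suc q) (s≤s z≤n)) (trans (sym (+-identityʳ 1ℚ)) (cong (1ℚ +_)
          (sym (⟦⟧-false (position (letter c) w ℕ.<? q) λ p<q → ℕ.<-irrefl refl
            (ℕ.<-≤-trans p<q (ℕ.≤-trans q≤ (ℕ.≤-reflexive (sym (position-absent (letter c) w (ℕ.n≤0⇒n≡0 z))))))))))

module _ {n : ℕ} (k : Fin n) where

  occurrences-single : ∀ β seen b → occurrences (k , β) (wordFrom k seen b) ≡ count k b
  occurrences-single β seen [] = refl
  occurrences-single β seen (b ∷ bs) with b Fin.≟ k
  occurrences-single false seen (b ∷ bs) | yes refl rewrite dec-true (b Fin.≟ b) refl = cong suc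
    (occurrences-single false seen bs)
  occurrences-single true  seen (b ∷ bs) | yes refl rewrite dec-true (b Fin.≟ b) refl = cong suc
    (occurrences-single true seen bs)
  ... | no b≢k with memb b seen
  ...   | true  rewrite dec-false (k Fin.≟ b) (b≢k ∘ sym) = occurrences-single β seen bs
  ...   | false rewrite dec-false (k Fin.≟ b) (b≢k ∘ sym) = occurrences-single β (b ∷ seen) bs

  ordered-single : ∀ seen b → 1 ℕ.≤ count k b →
    position (k , false) (wordFrom k seen b) ℕ.< position (k , true) (wordFrom k seen b)
  ordered-single seen (b ∷ bs) occurs with b Fin.≟ k
  ... | yes refl rewrite dec-true (b Fin.≟ b) refl = s≤s z≤n
  ... | no b≢k with memb b seen
  ...   | true  rewrite dec-false (k Fin.≟ b) (b≢k ∘ sym) = s≤s (ordered-single seen bs occurs)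
  ...   | false rewrite dec-false (k Fin.≟ b) (b≢k ∘ sym) = s≤s (ordered-single (b ∷ seen) bs occurs)

  module _ {i : Fin n} (i≢k : i ≢ k) where

    occurrences-seen : ∀ seen b → memb i seen ≡ true →
      occurrences (i , false) (wordFrom k seen b) ≡ 0 × occurrences (i , true) (wordFrom k seen b) ≡ count i b
    occurrences-seen seen [] _ = refl , refl
    occurrences-seen seen (b ∷ bs) i∈seen with b Fin.≟ k
    ... | yes refl rewrite dec-false (i Fin.≟ b) i≢k = occurrences-seen seen bs i∈seen
    ... | no b≢k with i Fin.≟ b
    ...   | yes refl rewrite i∈seen | dec-true (i Fin.≟ i) refl =
            proj₁ (occurrences-seen seen bs i∈seen) , cong suc (proj₂ (occurrences-seen seen bs i∈seen))
    ...   | no i≢b with memb b seen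
    ...     | true  rewrite dec-false (i Fin.≟ b) i≢b = occurrences-seen seen bs i∈seen
    ...     | false rewrite dec-false (i Fin.≟ b) i≢b = occurrences-seen (b ∷ seen) bs
              (trans (cong (if_then true else memb i seen) (dec-false (i Fin.≟ b) i≢b)) i∈seen)

    -- Up to its first occurrence i stays unseen; that occurrence yields the plain letter and hands
    -- over to `occurrences-seen`, after which every occurrence is barred. The order of the two
    -- letters follows.
    occurrences-unseen : ∀ seen b → memb i seen ≡ false → 1 ℕ.≤ count i b →
      occurrences (i , false) (wordFrom k seen b) ≡ 1
      × occurrences (i , true) (wordFrom k seen b) ≡ count i b ℕ.∸ 1
      × position (i , false) (wordFrom k seen b) ℕ.< position (i , true) (wordFrom k seen b)
    occurrences-unseen seen (b ∷ bs) i∉seen occurs with b Fin.≟ k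
    ... | yes refl rewrite dec-false (i Fin.≟ b) i≢k with occurrences-unseen seen bs i∉seen occurs
    ...   | p , q , r = p , q , s≤s (s≤s r)
    occurrences-unseen seen (b ∷ bs) i∉seen occurs | no b≢k with i Fin.≟ b
    ...   | yes refl rewrite i∉seen | dec-true (i Fin.≟ i) refl
            with occurrences-seen (i ∷ seen) bs (cong (if_then true else memb i seen) (dec-true (i Fin.≟ i) refl))
    ...     | p , q = cong suc p , q , s≤s z≤n
    occurrences-unseen seen (b ∷ bs) i∉seen occurs | no b≢k | no i≢b with memb b seen
    ...     | true  rewrite dec-false (i Fin.≟ b) i≢b with occurrences-unseen seen bs i∉seen occurs
    ...       | p , q , r = p , q , s≤s r
    occurrences-unseen seen (b ∷ bs) i∉seen occurs | no b≢k | no i≢b | false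
      rewrite dec-false (i Fin.≟ b) i≢b
      with occurrences-unseen (b ∷ seen) bs
              (trans (cong (if_then true else memb i seen) (dec-false (i Fin.≟ b) i≢b)) i∉seen) occurs
    ...       | p , q , r = p , q , s≤s r

-- What the geometry uses of a word. `below` says that the places are filled without gaps, so a
-- place equals the number of letters before it; this converts positions into sums of indicators.
record Arrangement (n : ℕ) : Set where
  field
    size    : ℕ
    place     : Coord n → ℕ
    place<size : ∀ c → place c ℕ.< size
    place-injective : ∀ {c c′} → place c ≡ place c′ → c ≡ c′
    below   : ∀ q → q ℕ.≤ size → ∑ (λ c → ⟦ place c ℕ.<? q ⟧) ≡ ι q
    ordered : ∀ i → place (inj₁ i) ℕ.< place (inj₂ i)

module _ {n : ℕ} (b : List (Fin n)) (k : Fin n) (bip : IsBipermutation n b k) where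

  letter-once : ∀ c → occurrences (letter c) (word k b) ≡ 1
  letter-once (inj₁ i) with i Fin.≟ k
  ... | yes refl = trans (occurrences-single k false [] b) (proj₁ (proj₂ bip))
  ... | no i≢k   = proj₁ (occurrences-unseen k i≢k [] b refl
    (ℕ.≤-trans (s≤s z≤n) (ℕ.≤-reflexive (sym (proj₂ (proj₂ bip) i i≢k)))))
  letter-once (inj₂ i) with i Fin.≟ k
  ... | yes refl = trans (occurrences-single k true [] b) (proj₁ (proj₂ bip))
  ... | no i≢k   = trans (proj₁ (proj₂ (occurrences-unseen k i≢k [] b refl
    (ℕ.≤-trans (s≤s z≤n) (ℕ.≤-reflexive (sym (proj₂ (proj₂ bip) i i≢k)))))))
                     (cong (ℕ._∸ 1) (proj₂ (proj₂ bip) i i≢k))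

  arrangement : Arrangement n
  arrangement = record
    { size = length (word k b)
    ; place = λ c → position (letter c) (word k b)
    ; place<size = present
    ; place-injective = λ {c} {c′} eq → letter-injective
      (position-injective (letter c) (letter c′) (word k b) (present c) eq)
    ; below = positions-below (word k b) (λ c → ℕ.≤-reflexive (letter-once c))
    ; ordered = ordered
    }
    where
    present : ∀ c → position (letter c) (word k b) ℕ.< length (word k b)
    present c = position-present (letter c) (word k b) (ℕ.≤-reflexive (sym (letter-once c)))
    ordered : ∀ i → position (i , false) (word k b) ℕ.< position (i , true) (word k b)
    ordered i with i Fin.≟ k
    ... | yes refl = ordered-single k [] b (ℕ.≤-reflexive (sym (proj₁ (proj₂ bip))))
    ... | no i≢k = proj₂ (proj₂ (occurrences-unseen k i≢k [] b refl
      (ℕ.≤-trans (s≤s z≤n) (ℕ.≤-reflexive (sym (proj₂ (proj₂ bip) i i≢k))))))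

-- Tournaments and points of the harmonic polytope

halve-≡ : ∀ {p q} → 2ℚ * p ≡ 2ℚ * q → p ≡ q
halve-≡ eq = ≤-antisym (halve-≤ (≤-reflexive eq)) (halve-≤ (≤-reflexive (sym eq)))

χ : ∀ {n} → Subset n → Fin n → ℚ
χ S i = if lookup S i then 1ℚ else 0ℚ

if-* : ∀ b (p : ℚ) → (if b then p else 0ℚ) ≡ (if b then 1ℚ else 0ℚ) * p
if-* true  p = sym (*-identityˡ p)
if-* false p = sym (*-zeroˡ p)

sumOver-χ : ∀ {n} (S : Subset n) f → sumOver S f ≡ Σℚ n (λ i → χ S i * f i)
sumOver-χ S f = Σ-cong (λ i → if-* (lookup S i) (f i))

Idempotent : ∀ {n} → (Fin n → ℚ) → Set
Idempotent f = ∀ i → f i * f i ≡ f i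

if-idem : ∀ b → (if b then 1ℚ else 0ℚ) * (if b then 1ℚ else 0ℚ) ≡ (if b then 1ℚ else 0ℚ)
if-idem true  = refl
if-idem false = refl

χ-idem : ∀ {n} (S : Subset n) → Idempotent (χ S)
χ-idem S i = if-idem (lookup S i)

χ-nonneg : ∀ {n} (S : Subset n) i → 0ℚ ≤ χ S i
χ-nonneg S i with lookup S i
... | true  = 0≤1
... | false = ≤-refl

χ≤1 : ∀ {n} (S : Subset n) i → χ S i ≤ 1ℚ
χ≤1 S i with lookup S i
... | true  = ≤-refl
... | false = 0≤1

Σ-χ : ∀ {n} (S : Subset n) → Σℚ n (χ S) ≡ ι ∣ S ∣
Σ-χ []          = refl
Σ-χ (true ∷ S)  = cong (1ℚ +_) (Σ-χ S)
Σ-χ (false ∷ S) = trans (+-identityˡ (Σℚ _ (χ S))) (Σ-χ S)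

χ-∈ : ∀ {n} {S : Subset n} {i} → i ∈ S → χ S i ≡ 1ℚ
χ-∈ i∈S = cong (if_then 1ℚ else 0ℚ) ([]=⇒lookup i∈S)

Matrix : ℕ → Set
Matrix n = Fin n → Fin n → ℚ

ΣΣ : ∀ {n} → Matrix n → ℚ
ΣΣ {n} f = Σℚ n (λ i → Σℚ n (f i))

ΣΣ-cong : ∀ {n} {f g : Matrix n} → (∀ i j → f i j ≡ g i j) → ΣΣ f ≡ ΣΣ g
ΣΣ-cong eq = Σ-cong (λ i → Σ-cong (eq i))

ΣΣ-+ : ∀ {n} (f g : Matrix n) → ΣΣ (λ i j → f i j + g i j) ≡ ΣΣ f + ΣΣ g
ΣΣ-+ {n} f g = trans (Σ-cong (λ i → Σ-+ (f i) (g i))) (Σ-+ (λ i → Σℚ n (f i)) (λ i → Σℚ n (g i)))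

ΣΣ-- : ∀ {n} (f g : Matrix n) → ΣΣ (λ i j → f i j - g i j) ≡ ΣΣ f - ΣΣ g
ΣΣ-- {n} f g = trans (Σ-cong (λ i → Σ-- (f i) (g i))) (Σ-- (λ i → Σℚ n (f i)) (λ i → Σℚ n (g i)))

-- A linear order given by its matrix, with `beats j i` equal to 1 when j comes before i. Sums of
-- ranks then become double sums, which transposition evaluates.
record Tournament (n : ℕ) : Set where
  field
    beats  : Matrix n
    nonneg : ∀ i j → 0ℚ ≤ beats i j
    total  : ∀ i j → beats i j + beats j i + δ i j ≡ 1ℚ

  rank : Fin n → ℚ
  rank i = 1ℚ + Σℚ n (λ j → beats j i)

δ-sym : ∀ {n} (i j : Fin n) → δ i j ≡ δ j i
δ-sym i j = ⟦⟧-cong (i Fin.≟ j) (j Fin.≟ i) sym sym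

reverse : ∀ {n} → Tournament n → Tournament n
reverse P = record
  { beats = λ i j → beats j i ; nonneg = λ i j → nonneg j i
  ; total = λ i j → trans (cong (beats j i + beats i j +_) (δ-sym i j)) (total j i) }
  where open Tournament P

<-trichotomy : ∀ p q → p ≢ q → ⟦ p ℕ.<? q ⟧ + ⟦ q ℕ.<? p ⟧ ≡ 1ℚ
<-trichotomy p q p≢q with ℕ.<-cmp p q
... | tri< p<q _ q≮p = cong₂ _+_ (⟦⟧-true (p ℕ.<? q) p<q) (⟦⟧-false (q ℕ.<? p) q≮p)
... | tri≈ _ p≡q _   = ⊥-elim (p≢q p≡q)
... | tri> p≮q _ q<p = cong₂ _+_ (⟦⟧-false (p ℕ.<? q) p≮q) (⟦⟧-true (q ℕ.<? p) q<p)

byOrder : ∀ {n} (p : Fin n → ℕ) → (∀ {i j} → p i ≡ p j → i ≡ j) → Tournament n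
byOrder p inj = record
  { beats = λ i j → ⟦ p i ℕ.<? p j ⟧ ; nonneg = λ i j → ⟦⟧-nonneg (p i ℕ.<? p j) ; total = tot }
  where
  tot : ∀ i j → ⟦ p i ℕ.<? p j ⟧ + ⟦ p j ℕ.<? p i ⟧ + δ i j ≡ 1ℚ
  tot i j with i Fin.≟ j
  ... | yes refl = cong (λ t → t + t + 1ℚ) (⟦⟧-false (p i ℕ.<? p i) (ℕ.<-irrefl refl))
  ... | no i≢j   = trans (+-identityʳ (⟦ p i ℕ.<? p j ⟧ + ⟦ p j ℕ.<? p i ⟧)) (<-trichotomy (p i) (p j) (i≢j ∘ inj))

module _ {n} (P : Tournament n) where
  open Tournament P

  -- Adding the sum to its transpose turns beats into 1 − δ.
  restricted-pairs : ∀ f → Idempotent f →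
    2ℚ * ΣΣ (λ i j → f i * (f j * beats j i)) ≡ Σℚ n f * Σℚ n f - Σℚ n f
  restricted-pairs f idem = begin
    2ℚ * A
      ≡⟨ ((∀ a → 2ℚ * a ≡ a + a) ∋ solve-∀ ℚ-ring) A ⟩
    A + A
      ≡⟨ cong (A +_) (Σ-swap n n (λ i j → f i * (f j * beats j i))) ⟩
    A + ΣΣ (λ j i → f i * (f j * beats j i))
      ≡⟨ sym (ΣΣ-+ (λ i j → f i * (f j * beats j i)) (λ i j → f j * (f i * beats i j))) ⟩
    ΣΣ (λ i j → f i * (f j * beats j i) + f j * (f i * beats i j))
      ≡⟨ ΣΣ-cong (λ i j → trans (((∀ a b x y d → a * (b * x) + b * (a * y) ≡ a * (b * (y + x + d)) - d *
        (a * b)) ∋ solve-∀ ℚ-ring) (f i) (f j) (beats j i) (beats i j) (δ i j))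
           (cong₂ (λ t u → f i * (f j * t) - u * (f i * f j)) (total i j) (δ-sym i j))) ⟩
    ΣΣ (λ i j → f i * (f j * 1ℚ) - δ j i * (f i * f j))
      ≡⟨ ΣΣ-- (λ i j → f i * (f j * 1ℚ)) (λ i j → δ j i * (f i * f j)) ⟩
    ΣΣ (λ i j → f i * (f j * 1ℚ)) - ΣΣ (λ i j → δ j i * (f i * f j))
      ≡⟨ cong₂ _-_
           (trans (Σ-cong (λ i → trans (Σ-*ˡ (f i) (λ j → f j * 1ℚ))
             (cong (f i *_) (Σ-cong (λ j → *-identityʳ (f j)))))) (Σ-*ʳ (Σℚ n f) f))
           (Σ-cong (λ i → trans (Σ-δ i (λ j → f i * f j)) (idem i))) ⟩
    Σℚ n f * Σℚ n f - Σℚ n f ∎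
    where
    open ≡-Reasoning
    A = ΣΣ (λ i j → f i * (f j * beats j i))

  weighted-rank : ∀ f → Σℚ n (λ i → f i * rank i) ≡ Σℚ n f + ΣΣ (λ i j → f i * beats j i)
  weighted-rank f = trans
    (Σ-cong (λ i → trans (((∀ a b → a * (1ℚ + b) ≡ a + a * b) ∋ solve-∀ ℚ-ring) (f i) (Σℚ n (λ j → beats j i)))
      (cong (f i +_) (sym (Σ-*ˡ (f i) (λ j → beats j i))))))
    (Σ-+ f (λ i → Σℚ n (λ j → f i * beats j i)))

  -- The hypothesis says that f is the indicator of an initial segment: whatever beats a member is a
  -- member. Its ranks are then 1, ..., s. The factor 2 avoids halves.
  rank-sum-≡ : ∀ f → Idempotent f → (∀ i j → f i * beats j i ≡ f i * (f j * beats j i)) →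
    2ℚ * Σℚ n (λ i → f i * rank i) ≡ Σℚ n f * Σℚ n f + Σℚ n f
  rank-sum-≡ f idem closed = trans (cong (2ℚ *_) (trans (weighted-rank f) (cong (Σℚ n f +_) (ΣΣ-cong closed))))
    (trans (*-distribˡ-+ 2ℚ (Σℚ n f) (ΣΣ (λ i j → f i * (f j * beats j i))))
    (trans (cong (2ℚ * Σℚ n f +_) (restricted-pairs f idem))
      (((∀ s → 2ℚ * s + (s * s - s) ≡ s * s + s) ∋ solve-∀ ℚ-ring) (Σℚ n f))))

  -- Discarding the pairs whose winner lies outside S leaves the count within S, which
  -- `restricted-pairs` evaluates.
  rank-sum-≥ : ∀ (S : Subset n) → ι ∣ S ∣ * ι ∣ S ∣ + ι ∣ S ∣ ≤ 2ℚ * Σℚ n (λ i → χ S i * rank i)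
  rank-sum-≥ S = subst₂ _≤_ left (cong (2ℚ *_) (sym (weighted-rank f)))
    (*-monoˡ-nonneg 0≤2 (+-monoʳ-≤ (Σℚ n f) (Σ-mono (λ i → Σ-mono (λ j →
      *-monoˡ-nonneg (χ-nonneg S i) (subst (f j * beats j i ≤_) (*-identityˡ (beats j i))
        (*-monoʳ-≤-nonNeg (beats j i) ⦃ nonNegative (nonneg j i) ⦄ (χ≤1 S j))))))))
    where
    f = χ S
    left : 2ℚ * (Σℚ n f + ΣΣ (λ i j → f i * (f j * beats j i))) ≡ ι ∣ S ∣ * ι ∣ S ∣ + ι ∣ S ∣
    left = trans (*-distribˡ-+ 2ℚ (Σℚ n f) (ΣΣ (λ i j → f i * (f j * beats j i))))
      (trans (cong (2ℚ * Σℚ n f +_) (restricted-pairs f (χ-idem S)))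
        (trans (((∀ s → 2ℚ * s + (s * s - s) ≡ s * s + s) ∋ solve-∀ ℚ-ring) (Σℚ n f)) (cong (λ s → s * s + s) (Σ-χ S))))

  rank-total : 2ℚ * Σℚ n rank ≡ ι n * ι n + ι n
  rank-total = trans (cong (2ℚ *_) (Σ-cong (λ i → sym (*-identityˡ (rank i)))))
    (trans (rank-sum-≡ (λ _ → 1ℚ) (λ _ → refl) (λ i j → cong (1ℚ *_) (sym (*-identityˡ (beats j i)))))
      (cong (λ s → s * s + s) (Σ-one n)))

rankPoint : ∀ {n} → Tournament n → Tournament n → Fin n → Point (Coord n)
rankPoint P Q k (inj₁ i) = Tournament.rank P i + δ i k
rankPoint P Q k (inj₂ i) = Tournament.rank Q i + δ i k

double-half : ∀ a → 2ℚ * (ℕ→ℚ a * ½ + 1ℚ) ≡ ι a + 2ℚ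
double-half a = trans (((∀ x → 2ℚ * (x * ½ + 1ℚ) ≡ x + 2ℚ) ∋ solve-∀ ℚ-ring) (ℕ→ℚ a)) (cong (_+ 2ℚ) (ℕ→ℚ≡ι a))

ι-m*[m+1] : ∀ m → ι (m ℕ.* (m ℕ.+ 1)) ≡ ι m * ι m + ι m
ι-m*[m+1] m = trans (ι-* m (m ℕ.+ 1)) (trans (cong (ι m *_) (ι-+ m 1))
  (((∀ a → a * (a + 1ℚ) ≡ a * a + a) ∋ solve-∀ ℚ-ring) (ι m)))

coordinate-sum : ∀ n → 2ℚ * (ℕ→ℚ (n ℕ.* (n ℕ.+ 1)) * ½ + 1ℚ) ≡ ι n * ι n + ι n + 2ℚ
coordinate-sum n = trans (double-half (n ℕ.* (n ℕ.+ 1))) (cong (_+ 2ℚ) (ι-m*[m+1] n))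

bisubset-bound : ∀ s t → 2ℚ * (ℕ→ℚ (s ℕ.* (s ℕ.+ 1) ℕ.+ t ℕ.* (t ℕ.+ 1)) * ½ + 1ℚ)
  ≡ ((ι s * ι s + ι s) + (ι t * ι t + ι t)) + 2ℚ
bisubset-bound s t = trans (double-half (s ℕ.* (s ℕ.+ 1) ℕ.+ t ℕ.* (t ℕ.+ 1)))
  (cong (_+ 2ℚ) (trans (ι-+ (s ℕ.* (s ℕ.+ 1)) (t ℕ.* (t ℕ.+ 1))) (cong₂ _+_ (ι-m*[m+1] s) (ι-m*[m+1] t))))

rank-sum-shift : ∀ {n} (P : Tournament n) k f → let open Tournament P in
  2ℚ * Σℚ n (λ i → f i * (rank i + δ i k)) ≡ 2ℚ * Σℚ n (λ i → f i * rank i) + 2ℚ * f k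
rank-sum-shift {n} P k f = trans (cong (2ℚ *_) (trans
    (Σ-cong (λ i → ((∀ f r d → f * (r + d) ≡ f * r + d * f) ∋ solve-∀ ℚ-ring) (f i) (rank i) (δ i k)))
    (trans (Σ-+ (λ i → f i * rank i) (λ i → δ i k * f i)) (cong (Σℚ n (λ i → f i * rank i) +_) (Σ-δ k f)))))
  (*-distribˡ-+ 2ℚ (Σℚ n (λ i → f i * rank i)) (f k))
  where open Tournament P

rank-coordinate-sum : ∀ {n} (P : Tournament n) k →
  2ℚ * Σℚ n (λ i → Tournament.rank P i + δ i k) ≡ ι n * ι n + ι n + 2ℚ
rank-coordinate-sum {n} P k = trans (cong (2ℚ *_) (trans (Σ-+ rank (λ i → δ i k)) (cong (Σℚ n rank +_) (Σ-δ1 k))))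
  (trans (*-distribˡ-+ 2ℚ (Σℚ n rank) 1ℚ) (cong (_+ 2ℚ * 1ℚ) (rank-total P)))
  where open Tournament P

-- The ranks give the two triangular numbers of a bisubset inequality; the remaining 1 is `covered`,
-- since k belongs to S ∪ T.
rankPoint∈Harmonic : ∀ {n} (P Q : Tournament n) k → Harmonic n (rankPoint P Q k)
rankPoint∈Harmonic {n} P Q k =
  halve-≡ (trans (rank-coordinate-sum P k) (sym (coordinate-sum n))) ,
  halve-≡ (trans (rank-coordinate-sum Q k) (sym (coordinate-sum n))) ,
  bound
  where
  module P = Tournament P
  module Q = Tournament Q
  bound : ∀ S T → IsBisubset S T → _
  bound S T (_ , _ , S∪T≡⊤ , _) = halve-≤ (subst₂ _≤_
    (sym (bisubset-bound ∣ S ∣ ∣ T ∣))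
    (trans (trans (((∀ a b c d → (a + b) + 2ℚ * (c + d) ≡ (a + 2ℚ * c) + (b + 2ℚ * d)) ∋ solve-∀ ℚ-ring)
        (2ℚ * Σℚ n (λ i → χ S i * P.rank i)) (2ℚ * Σℚ n (λ i → χ T i * Q.rank i)) (χ S k) (χ T k))
      (sym (cong₂ _+_ (rank-sum-shift P k (χ S)) (rank-sum-shift Q k (χ T)))))
      (trans (sym (*-distribˡ-+ 2ℚ (Σℚ n (λ i → χ S i * (P.rank i + δ i k))) (Σℚ n (λ i → χ T i * (Q.rank i + δ i k)))))
        (cong (2ℚ *_) (sym (cong₂ _+_ (sumOver-χ S (λ i → P.rank i + δ i k)) (sumOver-χ T (λ i → Q.rank i + δ i k)))))))
    (+-mono-≤ (+-mono-≤ (rank-sum-≥ P S) (rank-sum-≥ Q T)) (*-monoˡ-nonneg 0≤2 covered)))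
    where
    covered : 1ℚ ≤ χ S k + χ T k
    covered with x∈p∪q⁻ S T (subst (k ∈_) (sym S∪T≡⊤) ∈⊤)
    ... | inj₁ k∈S = ≤-by (χ T k) (χ-nonneg T k) (cong (_+ χ T k) (χ-∈ k∈S))
    ... | inj₂ k∈T = ≤-by (χ S k) (χ-nonneg S k) (trans (cong (χ S k +_) (χ-∈ k∈T)) (+-comm (χ S k) 1ℚ))

-- The vertices of the bipermutahedron

module Places {n} (A : Arrangement n) where
  open Arrangement A public

  first second : Tournament n
  first  = byOrder (place ∘ inj₁) (inj₁-injective ∘ place-injective)
  second = reverse (byOrder (place ∘ inj₂) (inj₂-injective ∘ place-injective))

  module F = Tournament first
  module S = Tournament second

  crossing : Matrix n
  crossing i j = ⟦ place (inj₂ j) ℕ.<? place (inj₁ i) ⟧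

  crossings : ℚ
  crossings = ΣΣ crossing

  crossing-nonneg : ∀ i j → 0ℚ ≤ crossing i j
  crossing-nonneg i j = ⟦⟧-nonneg (place (inj₂ j) ℕ.<? place (inj₁ i))

  place-inj₁ : ∀ i → ι (place (inj₁ i)) ≡ Σℚ n (λ j → F.beats j i) + Σℚ n (crossing i)
  place-inj₁ i = sym (below (place (inj₁ i)) (ℕ.<⇒≤ (place<size (inj₁ i))))

  -- Complementary counting, as ranks of second occurrences run from the right: before the bar of i
  -- come all n plain letters and the n - 1 other bars, except those that come after it.
  place-inj₂ : ∀ i → ι (place (inj₂ i)) ≡
    2ℚ * ι n - 1ℚ - Σℚ n (λ j → S.beats j i) - Σℚ n (λ j → crossing j i)
  place-inj₂ i = trans (sym (below (place (inj₂ i)) (ℕ.<⇒≤ (place<size (inj₂ i)))))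
    (trans (cong₂ _+_
      (trans (Σ-cong (λ j → before j)) (trans (Σ-- (λ _ → 1ℚ) (λ j → crossing j i)) (cong (_- c) (Σ-one n))))
      (trans (Σ-cong (λ j → trans (((∀ a b d → b ≡ (a + b + d) - d - a) ∋ solve-∀ ℚ-ring) (S.beats j i)
        (S.beats i j) (δ j i))
               (cong (λ t → t - δ j i - S.beats j i) (S.total j i))))
        (trans (Σ-- (λ j → 1ℚ - δ j i) (λ j → S.beats j i))
          (cong (_- s) (trans (Σ-- (λ _ → 1ℚ) (λ j → δ j i)) (cong₂ _-_ (Σ-one n) (Σ-δ1 i)))))))
      (((∀ n c s → (n - c) + (n - 1ℚ - s) ≡ 2ℚ * n - 1ℚ - s - c) ∋ solve-∀ ℚ-ring) (ι n) c s))
    where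
    c = Σℚ n (λ j → crossing j i)
    s = Σℚ n (λ j → S.beats j i)
    before : ∀ j → ⟦ place (inj₁ j) ℕ.<? place (inj₂ i) ⟧ ≡ 1ℚ - crossing j i
    before j = trans (((∀ a b → a ≡ (a + b) - b) ∋ solve-∀ ℚ-ring) ⟦ place (inj₁ j) ℕ.<? place (inj₂ i) ⟧
      (crossing j i))
      (cong (_- crossing j i) (<-trichotomy (place (inj₁ j)) (place (inj₂ i)) (λ eq → case (place-injective eq))))
      where
      case : inj₁ j ≢ inj₂ i
      case ()

  -- If both crossings occurred, the bar of i would precede j, j its own bar, this bar i, and i its
  -- own bar: a cycle.
  crossing-antisym : ∀ i j → crossing i j + crossing j i ≤ 1ℚ - δ j i
  crossing-antisym i j with j Fin.≟ i
  ... | yes refl = ≤-reflexive (cong (λ t → t + t)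
    (⟦⟧-false (place (inj₂ i) ℕ.<? place (inj₁ i)) (ℕ.<-asym (ordered i))))
  ... | no _ = ⟦⟧-exclusive (place (inj₂ j) ℕ.<? place (inj₁ i)) (place (inj₂ i) ℕ.<? place (inj₁ j))
    (λ j̄<i ī<j → ℕ.<-asym (ℕ.<-trans (ordered i) ī<j) (ℕ.<-trans (ordered j) j̄<i))

  crossings-bound : 2ℚ * crossings ≤ ι n * ι n - ι n
  crossings-bound = subst₂ _≤_
    (trans (ΣΣ-+ crossing (λ i j → crossing j i)) (trans (cong (crossings +_) (sym (Σ-swap n n crossing)))
      (((∀ a → a + a ≡ 2ℚ * a) ∋ solve-∀ ℚ-ring) crossings)))
    (trans (ΣΣ-- {n} (λ _ _ → 1ℚ) (λ i j → δ j i)) (cong₂ _-_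
      (trans (Σ-cong {n} (λ _ → Σ-one n)) (Σ-const n (ι n)))
      (trans (Σ-cong {n} (λ i → Σ-δ1 i)) (Σ-one n))))
    (Σ-mono (λ i → Σ-mono (crossing-antisym i)))

  module _ (k : Fin n) where

    harmonicPoint : Point (Coord n)
    harmonicPoint = rankPoint first second k

    -- The weight that makes both coordinate sums of the residual equal to −n(n+1)−2.
    excess : ℚ
    excess = ι n * ι n - 2ℚ - 2ℚ * crossings

    residual : Point (Coord n)
    residual (inj₁ i) = 2ℚ * Σℚ n (crossing i) - (2ℚ * ι n + 1ℚ) + δ i k * excess
    residual (inj₂ i) = 2ℚ * Σℚ n (λ j → crossing j i) - (2ℚ * ι n + 1ℚ) + δ i k * excess

    excess-nonneg : 2ℚ ≤ ι n → 0ℚ ≤ excess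
    excess-nonneg 2≤n = subst (0ℚ ≤_)
      (((∀ n c → (n * n - n - c) + (n - 2ℚ) ≡ n * n - 2ℚ - c) ∋ solve-∀ ℚ-ring) (ι n) (2ℚ * crossings))
      (+-nonneg (p≤q⇒0≤q-p crossings-bound) (p≤q⇒0≤q-p 2≤n))

    -- This common bound is attained at a coordinate without crossings and without a contribution of
    -- the excess; the upper bound for the quotient looks for two such coordinates at once.
    residual-≥ : 2ℚ ≤ ι n → ∀ c → - (2ℚ * ι n + 1ℚ) ≤ residual c
    residual-≥ 2≤n (inj₁ i) = ≤-by (2ℚ * Σℚ n (crossing i) + δ i k * excess)
      (+-nonneg (*-nonneg 0≤2 (Σ-nonneg (crossing-nonneg i))) (*-nonneg (⟦⟧-nonneg (i Fin.≟ k)) (excess-nonneg 2≤n)))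
      (((∀ a b c → a - b + c ≡ - b + (a + c)) ∋ solve-∀ ℚ-ring) (2ℚ * Σℚ n (crossing i)) (2ℚ * ι n + 1ℚ)
        (δ i k * excess))
    residual-≥ 2≤n (inj₂ i) = ≤-by (2ℚ * Σℚ n (λ j → crossing j i) + δ i k * excess)
      (+-nonneg (*-nonneg 0≤2 (Σ-nonneg (λ j → crossing-nonneg j i)))
        (*-nonneg (⟦⟧-nonneg (i Fin.≟ k)) (excess-nonneg 2≤n)))
      (((∀ a b c → a - b + c ≡ - b + (a + c)) ∋ solve-∀ ℚ-ring) (2ℚ * Σℚ n (λ j → crossing j i)) (2ℚ * ι n + 1ℚ)
        (δ i k * excess))

    -- The excess contains -2 for every crossing, so splitting off its multiple of m charges -m to
    -- each crossing pair. For fixed ℓ and m, only the crossing sum and the term with `excess`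
    -- depend on the arrangement and on k. The identity holds for every m, which allows two
    -- arrangements to be compared at the same m.
    residual-support : ∀ ℓ m → ℓ ∙ residual ≡
      2ℚ * ΣΣ (λ i j → crossing i j * (ℓ (inj₁ i) + ℓ (inj₂ j) - m))
      + (ι n * ι n - 2ℚ) * m + excess * (ℓ (inj₁ k) + ℓ (inj₂ k) - m)
      - (2ℚ * ι n + 1ℚ) * ∑ ℓ
    residual-support ℓ m = begin
      ℓ ∙ residual
        ≡⟨ cong₂ _+_ (part (ℓ ∘ inj₁) (λ i → Σℚ n (crossing i))) (part (ℓ ∘ inj₂) (λ j → Σℚ n (λ i → crossing i j))) ⟩
      (2ℚ * a₁ - K * w₁ + w₁k * excess) + (2ℚ * a₂ - K * w₂ + w₂k * excess)
        ≡⟨ ((∀ a₁ a₂ K w₁ w₂ u₁ u₂ n c m →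
              (2ℚ * a₁ - K * w₁ + u₁ * (n * n - 2ℚ - 2ℚ * c)) + (2ℚ * a₂ - K * w₂ + u₂ * (n * n - 2ℚ - 2ℚ * c))
              ≡ 2ℚ * ((a₁ + a₂) - c * m) + (n * n - 2ℚ) * m + (n * n - 2ℚ - 2ℚ * c) * (u₁ + u₂ - m) - K * (w₁ + w₂))
            ∋ solve-∀ ℚ-ring) a₁ a₂ K w₁ w₂ w₁k w₂k (ι n) crossings m ⟩
      2ℚ * ((a₁ + a₂) - crossings * m) + (ι n * ι n - 2ℚ) * m + excess * (w₁k + w₂k - m) - K * ∑ ℓ
        ≡⟨ cong (λ t → 2ℚ * t + (ι n * ι n - 2ℚ) * m + excess * (w₁k + w₂k - m) - K * ∑ ℓ) (sym pairs) ⟩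
      2ℚ * ΣΣ (λ i j → crossing i j * (ℓ (inj₁ i) + ℓ (inj₂ j) - m))
        + (ι n * ι n - 2ℚ) * m + excess * (w₁k + w₂k - m) - K * ∑ ℓ ∎
      where
      open ≡-Reasoning
      K w₁k w₂k a₁ a₂ w₁ w₂ : ℚ
      K = 2ℚ * ι n + 1ℚ
      w₁k = ℓ (inj₁ k)
      w₂k = ℓ (inj₂ k)
      w₁ = Σℚ n (ℓ ∘ inj₁)
      w₂ = Σℚ n (ℓ ∘ inj₂)
      a₁ = Σℚ n (λ i → ℓ (inj₁ i) * Σℚ n (crossing i))
      a₂ = Σℚ n (λ j → ℓ (inj₂ j) * Σℚ n (λ i → crossing i j))
      part : ∀ (w x : Fin n → ℚ) →
        Σℚ n (λ i → w i * (2ℚ * x i - K + δ i k * excess)) ≡ 2ℚ * Σℚ n (λ i → w i * x i) - K * Σℚ n w + w k * excess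
      part w x = trans
        (Σ-cong (λ i → ((∀ w x K d e → w * (2ℚ * x - K + d * e) ≡ 2ℚ * (w * x) - K * w + d *
          (w * e)) ∋ solve-∀ ℚ-ring) (w i) (x i) K (δ i k) excess))
        (trans (Σ-+ (λ i → 2ℚ * (w i * x i) - K * w i) (λ i → δ i k * (w i * excess)))
          (cong₂ _+_ (trans (Σ-- (λ i → 2ℚ * (w i * x i)) (λ i → K * w i))
            (cong₂ _-_ (Σ-*ˡ 2ℚ (λ i → w i * x i)) (Σ-*ˡ K w)))
            (Σ-δ k (λ i → w i * excess))))
      pairs : ΣΣ (λ i j → crossing i j * (ℓ (inj₁ i) + ℓ (inj₂ j) - m)) ≡ (a₁ + a₂) - crossings * m
      pairs = trans (ΣΣ-cong (λ i j → ((∀ x u v m → x * (u + v - m) ≡ (u * x + v * x) - x * m) ∋ solve-∀ ℚ-ring)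
        (crossing i j) (ℓ (inj₁ i)) (ℓ (inj₂ j)) m))
        (trans (ΣΣ-- (λ i j → ℓ (inj₁ i) * crossing i j + ℓ (inj₂ j) * crossing i j) (λ i j → crossing i j * m))
        (cong₂ _-_
          (trans (ΣΣ-+ (λ i j → ℓ (inj₁ i) * crossing i j) (λ i j → ℓ (inj₂ j) * crossing i j))
            (cong₂ _+_ (Σ-cong (λ i → Σ-*ˡ (ℓ (inj₁ i)) (crossing i)))
              (trans (Σ-swap n n (λ i j → ℓ (inj₂ j) * crossing i j))
                (Σ-cong (λ j → Σ-*ˡ (ℓ (inj₂ j)) (λ i → crossing i j))))))
          (trans (Σ-cong (λ i → Σ-*ʳ m (crossing i))) (Σ-*ʳ m (λ i → Σℚ n (crossing i))))))

-- Vertices as twice a harmonic point plus a residual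

πval-ι : ∀ n p → πval n p ≡ 2ℚ * ι p + 1ℚ - 2ℚ * ι n
πval-ι n p = trans (/1-+ (ℤ.+ (2 ℕ.* p ℕ.+ 1)) (ℤ.- (ℤ.+ (2 ℕ.* n))))
  (cong₂ _+_ (trans (ℕ→ℚ≡ι (2 ℕ.* p ℕ.+ 1)) (trans (ι-+ (2 ℕ.* p) 1) (cong (_+ 1ℚ) (ι-* 2 p))))
    (trans (/1-neg (ℤ.+ (2 ℕ.* n))) (cong -_ (trans (ℕ→ℚ≡ι (2 ℕ.* n)) (ι-* 2 n)))))

module _ {n} (b : List (Fin n)) (k : Fin n) (bip : IsBipermutation n b k) where
  open Places (arrangement b k bip)

  private
    u₁ : ∀ i → uvec n b k (inj₁ i) ≡ 2ℚ * (Σℚ n (λ j → F.beats j i) + Σℚ n (crossing i)) + 1ℚ - 2ℚ * ι n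
    u₁ i = trans (πval-ι n (place (inj₁ i))) (cong (λ t → 2ℚ * t + 1ℚ - 2ℚ * ι n) (place-inj₁ i))

    u₂ : ∀ i → uvec n b k (inj₂ i) ≡ 2ℚ * (Σℚ n (λ j → S.beats j i) + Σℚ n (λ j → crossing j i)) + 1ℚ - 2ℚ * ι n
    u₂ i = trans (cong -_ (trans (πval-ι n (place (inj₂ i))) (cong (λ t → 2ℚ * t + 1ℚ - 2ℚ * ι n) (place-inj₂ i))))
      (((∀ n s c → - (2ℚ * (2ℚ * n - 1ℚ - s - c) + 1ℚ - 2ℚ * n) ≡ 2ℚ * (s + c) + 1ℚ - 2ℚ * n) ∋ solve-∀ ℚ-ring)
        (ι n) (Σℚ n (λ j → S.beats j i)) (Σℚ n (λ j → crossing j i)))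

    u-sum : Σℚ n (λ i → uvec n b k (inj₁ i)) ≡ 2ℚ * crossings - ι n * ι n
    u-sum = begin
      Σℚ n (λ i → uvec n b k (inj₁ i))
        ≡⟨ Σ-cong (λ i → trans (u₁ i) (((∀ f c n → 2ℚ * (f + c) + 1ℚ - 2ℚ * n ≡ 2ℚ * ((1ℚ + f) + c) -
          (1ℚ + 2ℚ * n)) ∋ solve-∀ ℚ-ring)
             (Σℚ n (λ j → F.beats j i)) (Σℚ n (crossing i)) (ι n))) ⟩
      Σℚ n (λ i → 2ℚ * (F.rank i + Σℚ n (crossing i)) - (1ℚ + 2ℚ * ι n))
        ≡⟨ trans (Σ-- (λ i → 2ℚ * (F.rank i + Σℚ n (crossing i))) (λ _ → 1ℚ + 2ℚ * ι n))
             (cong₂ _-_ (trans (Σ-*ˡ 2ℚ (λ i → F.rank i + Σℚ n (crossing i)))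
               (trans (cong (2ℚ *_) (Σ-+ F.rank (λ i → Σℚ n (crossing i)))) (*-distribˡ-+ 2ℚ (Σℚ n F.rank) crossings)))
               (Σ-const n (1ℚ + 2ℚ * ι n))) ⟩
      (2ℚ * Σℚ n F.rank + 2ℚ * crossings) - ι n * (1ℚ + 2ℚ * ι n)
        ≡⟨ cong (λ t → (t + 2ℚ * crossings) - ι n * (1ℚ + 2ℚ * ι n)) (rank-total first) ⟩
      ((ι n * ι n + ι n) + 2ℚ * crossings) - ι n * (1ℚ + 2ℚ * ι n)
        ≡⟨ ((∀ n c → ((n * n + n) + c) - n * (1ℚ + 2ℚ * n) ≡ c - n * n) ∋ solve-∀ ℚ-ring) (ι n) (2ℚ * crossings) ⟩
      2ℚ * crossings - ι n * ι n ∎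
      where open ≡-Reasoning

    combine : ∀ r x d → 2ℚ * (r + x) + 1ℚ - 2ℚ * ι n - d * (2ℚ * crossings - ι n * ι n)
      ≡ 2ℚ * ((1ℚ + r) + d) + (2ℚ * x - (2ℚ * ι n + 1ℚ) + d * excess k)
    combine r x d = ((∀ r x d n c → 2ℚ * (r + x) + 1ℚ - 2ℚ * n - d * (2ℚ * c - n * n)
      ≡ 2ℚ * ((1ℚ + r) + d) + (2ℚ * x - (2ℚ * n + 1ℚ) + d * (n * n - 2ℚ - 2ℚ * c))) ∋ solve-∀ ℚ-ring) r x d
        (ι n) crossings

  -- A value of π is twice a place plus a constant, and a place is a rank plus a number of
  -- crossings, up to constants and a reflection. The ranks go to the harmonic point, the crossings
  -- to the residual.
  vertex-decomposition : ∀ c → vertex n b k c ≡ 2ℚ * harmonicPoint k c + residual k c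
  vertex-decomposition (inj₁ i) = trans (cong₂ _-_ (u₁ i)
    (trans (if-* (does (i Fin.≟ k)) (Σℚ n (λ i → uvec n b k (inj₁ i)))) (cong (δ i k *_) u-sum)))
    (combine (Σℚ n (λ j → F.beats j i)) (Σℚ n (crossing i)) (δ i k))
  vertex-decomposition (inj₂ i) = trans (cong₂ _-_ (u₂ i)
    (trans (if-* (does (i Fin.≟ k)) (Σℚ n (λ i → uvec n b k (inj₁ i)))) (cong (δ i k *_) u-sum)))
    (combine (Σℚ n (λ j → S.beats j i)) (Σℚ n (λ j → crossing j i)) (δ i k))

-- Minimality on the cone of an arrangement

⟦⟧≤1 : ∀ {a} {P : Set a} (P? : Dec P) → ⟦ P? ⟧ ≤ 1ℚ
⟦⟧≤1 (yes _) = ≤-refl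
⟦⟧≤1 (no _)  = 0≤1

⟦⟧-complement : ∀ {a b} {P : Set a} {Q : Set b} (P? : Dec P) (Q? : Dec Q) → (P → ¬ Q) → (¬ P → Q) → ⟦ P? ⟧ ≡ 1ℚ - ⟦ Q? ⟧
⟦⟧-complement (yes p) Q? f g = sym (cong (λ t → 1ℚ - t) (⟦⟧-false Q? (f p)))
⟦⟧-complement (no ¬p) Q? f g = sym (cong (λ t → 1ℚ - t) (⟦⟧-true Q? (g ¬p)))

⟦⟧-idem : ∀ {a} {P : Set a} (P? : Dec P) → ⟦ P? ⟧ * ⟦ P? ⟧ ≡ ⟦ P? ⟧
⟦⟧-idem P? = if-idem (does P?)

⟦⟧-absorb : ∀ {a b c} {P : Set a} {Q : Set b} {R : Set c} (P? : Dec P) (Q? : Dec Q) (R? : Dec R) →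
  (P → R → Q) → ⟦ P? ⟧ * ⟦ R? ⟧ ≡ ⟦ P? ⟧ * (⟦ Q? ⟧ * ⟦ R? ⟧)
⟦⟧-absorb P? Q? (no _) _ = cong (⟦ P? ⟧ *_) (sym (*-zeroʳ ⟦ Q? ⟧))
⟦⟧-absorb (no _) Q? (yes r) _ = sym (*-zeroˡ (⟦ Q? ⟧ * 1ℚ))
⟦⟧-absorb (yes p) Q? (yes r) f = cong (λ t → 1ℚ * (t * 1ℚ)) (sym (⟦⟧-true Q? (f p r)))

-- Over x in [0,1] the product with y is least at x = 1 if y ≤ 0 and at x = 0 if y ≥ 0.
⟦⟧-minimal : ∀ {a} {P : Set a} (P? : Dec P) {x y} → 0ℚ ≤ x → x ≤ 1ℚ →
  (P → y ≤ 0ℚ) → (¬ P → 0ℚ ≤ y) → ⟦ P? ⟧ * y ≤ x * y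
⟦⟧-minimal (yes p) {x} {y} 0≤x x≤1 f g = ≤-by ((1ℚ - x) * (0ℚ - y)) (*-nonneg (p≤q⇒0≤q-p x≤1) (p≤q⇒0≤q-p (f p)))
  (((∀ x y → x * y ≡ 1ℚ * y + (1ℚ - x) * (0ℚ - y)) ∋ solve-∀ ℚ-ring) x y)
⟦⟧-minimal (no ¬p) {x} {y} 0≤x x≤1 f g = subst (_≤ x * y) (sym (*-zeroˡ y)) (*-nonneg 0≤x (g ¬p))

∑-- : ∀ {n} (f g : Coord n → ℚ) → ∑ (λ c → f c - g c) ≡ ∑ f - ∑ g
∑-- {n} f g = trans (cong₂ _+_ (Σ-- (f ∘ inj₁) (g ∘ inj₁)) (Σ-- (f ∘ inj₂) (g ∘ inj₂)))
  (((∀ a b c d → (a - b) + (c - d) ≡ (a + c) - (b + d)) ∋ solve-∀ ℚ-ring)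
    (Σℚ n (f ∘ inj₁)) (Σℚ n (g ∘ inj₁)) (Σℚ n (f ∘ inj₂)) (Σℚ n (g ∘ inj₂)))

-- Abel summation: the keys are lowered one level at a time.
abel : ∀ {n} M (C : ℕ → ℚ) (p : Coord n → ℕ) (g : Coord n → ℚ) → (∀ c → p c ℕ.≤ M) → ∑ g ≡ 0ℚ →
  (∀ q → q ℕ.< M → 0ℚ ≤ (C q - C (suc q)) * ∑ (λ c → ⟦ p c ℕ.<? suc q ⟧ * g c)) →
  0ℚ ≤ ∑ (λ c → C (p c) * g c)
abel {n} M C p g p≤M ∑g≡0 levels = subst (0ℚ ≤_)
  (∑-cong (λ c → cong (λ t → C t * g c) (ℕ.m≤n⇒m⊓n≡m (p≤M c)))) (truncated M ℕ.≤-refl)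
  where
  E : ℕ → ℚ
  E q = ∑ (λ c → C (p c ℕ.⊓ q) * g c)
  -- Raising the cap from q to q + 1 affects only the c with `p c` above q, whose coefficient drops
  -- from `C q` to `C (suc q)`. Since g sums to 0, the sum over these c is minus the sum over the
  -- rest.
  step : ∀ q c → C (p c ℕ.⊓ suc q) * g c ≡
    C (p c ℕ.⊓ q) * g c + (C q - C (suc q)) * (⟦ p c ℕ.<? suc q ⟧ * g c - g c)
  step q c = helper (p c ℕ.<? suc q)
    where
    helper : (P? : Dec (p c ℕ.< suc q)) → C (p c ℕ.⊓ suc q) * g c ≡
      C (p c ℕ.⊓ q) * g c + (C q - C (suc q)) * (⟦ P? ⟧ * g c - g c)
    helper (yes (s≤s p≤q)) rewrite ℕ.m≤n⇒m⊓n≡m p≤q | ℕ.m≤n⇒m⊓n≡m (ℕ.m≤n⇒m≤1+n p≤q) =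
      ((∀ c d e g → c * g ≡ c * g + (d - e) * (1ℚ * g - g)) ∋ solve-∀ ℚ-ring) (C (p c)) (C q) (C (suc q)) (g c)
    helper (no p≮) rewrite ℕ.m≥n⇒m⊓n≡n (ℕ.≮⇒≥ p≮) | ℕ.m≥n⇒m⊓n≡n (ℕ.≤-trans (ℕ.n≤1+n q) (ℕ.≮⇒≥ p≮)) =
      ((∀ d e g → e * g ≡ d * g + (d - e) * (0ℚ * g - g)) ∋ solve-∀ ℚ-ring) (C q) (C (suc q)) (g c)
  truncated : ∀ q → q ℕ.≤ M → 0ℚ ≤ E q
  truncated zero _ = ≤-reflexive (sym (trans (∑-cong (λ c → cong (λ t → C t * g c) (ℕ.m≥n⇒m⊓n≡n {p c} z≤n)))
    (trans (∑-*ˡ (C 0) g) (trans (cong (C 0 *_) ∑g≡0) (*-zeroʳ (C 0))))))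
  truncated (suc q) q<M = subst (0ℚ ≤_) (sym eq) (+-nonneg (truncated q (ℕ.<⇒≤ q<M)) (levels q q<M))
    where
    G : ℚ
    G = ∑ (λ c → ⟦ p c ℕ.<? suc q ⟧ * g c)
    eq : E (suc q) ≡ E q + (C q - C (suc q)) * G
    eq = trans (∑-cong (step q)) (trans (∑-+ (λ c → C (p c ℕ.⊓ q) * g c)
      (λ c → (C q - C (suc q)) * (⟦ p c ℕ.<? suc q ⟧ * g c - g c)))
      (cong (E q +_) (trans (∑-*ˡ (C q - C (suc q)) (λ c → ⟦ p c ℕ.<? suc q ⟧ * g c - g c))
        (cong ((C q - C (suc q)) *_) (trans (∑-- (λ c → ⟦ p c ℕ.<? suc q ⟧ * g c) g)
          (trans (cong (λ t → G - t) ∑g≡0) (((∀ a → a - 0ℚ ≡ a) ∋ solve-∀ ℚ-ring) G)))))))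

-- The functional ℓ lies in the cone of the arrangement: letters occur by decreasing key, where i has
-- key ℓ(x_i), ī has key m − ℓ(y_i), and m is the least value of ℓ(x_i) + ℓ(y_i), attained at k.
record Sorted {n} (A : Arrangement n) (k : Fin n) (ℓ : Coord n → ℚ) : Set where
  open Arrangement A
  m : ℚ
  m = ℓ (inj₁ k) + ℓ (inj₂ k)
  field
    key      : ℕ → ℚ
    antitone : ∀ {p q} → p ℕ.≤ q → q ℕ.< size → key q ≤ key p
    key₁     : ∀ i → key (place (inj₁ i)) ≡ ℓ (inj₁ i)
    key₂     : ∀ i → key (place (inj₂ i)) ≡ m - ℓ (inj₂ i)
    minimal  : ∀ i → m ≤ ℓ (inj₁ i) + ℓ (inj₂ i)

module _ {n} {A : Arrangement n} {k : Fin n} {ℓ : Coord n → ℚ} (sorted : Sorted A k ℓ) where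
  open Places A
  open Sorted sorted

  -- Both sides are expanded by `residual-support` with the m of ℓ. The excess term is 0 at k, where
  -- m is attained, and nonnegative at k′. For a pair i, j the order of the keys forces a crossing
  -- only where its coefficient is at most 0, and none only where it is at least 0.
  residual-minimal : 2ℚ ≤ ι n → ∀ (B : Arrangement n) k′ → ℓ ∙ residual k ≤ ℓ ∙ Places.residual B k′
  residual-minimal 2≤n B k′ = subst₂ _≤_ (sym (residual-support k ℓ m)) (sym (B.residual-support k′ ℓ m))
    (+-monoˡ-≤ (- ((2ℚ * ι n + 1ℚ) * ∑ ℓ)) (+-mono-≤ (+-monoˡ-≤ ((ι n * ι n - 2ℚ) * m)
      (*-monoˡ-nonneg 0≤2 (Σ-mono (λ i → Σ-mono (termwise i)))))
      (≤-trans (≤-reflexive (trans (cong (excess k *_) (+-inverseʳ m)) (*-zeroʳ (excess k))))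
        (*-nonneg (B.excess-nonneg k′ 2≤n) (p≤q⇒0≤q-p (minimal k′))))))
    where
    module B = Places B
    termwise : ∀ i j → crossing i j * (ℓ (inj₁ i) + ℓ (inj₂ j) - m) ≤ B.crossing i j * (ℓ (inj₁ i) + ℓ (inj₂ j) - m)
    termwise i j = ⟦⟧-minimal (place (inj₂ j) ℕ.<? place (inj₁ i)) (B.crossing-nonneg i j)
      (⟦⟧≤1 (B.place (inj₂ j) ℕ.<? B.place (inj₁ i)))
      (λ j̄<i → ≤-by (m - ℓ (inj₂ j) - ℓ (inj₁ i))
        (p≤q⇒0≤q-p (subst₂ _≤_ (key₁ i) (key₂ j) (antitone (ℕ.<⇒≤ j̄<i) (place<size (inj₁ i)))))
        (((∀ m u v → 0ℚ ≡ (u + v - m) + (m - v - u)) ∋ solve-∀ ℚ-ring) m (ℓ (inj₁ i)) (ℓ (inj₂ j))))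
      (λ j̄≮i → subst (0ℚ ≤_) (((∀ m u v → u - (m - v) ≡ u + v - m) ∋ solve-∀ ℚ-ring) m (ℓ (inj₁ i)) (ℓ (inj₂ j)))
        (p≤q⇒0≤q-p (subst₂ _≤_ (key₂ j) (key₁ i) (antitone (ℕ.≮⇒≥ j̄≮i) (place<size (inj₂ j))))))

  harmonic-minimal : ∀ h → Harmonic n h → ℓ ∙ harmonicPoint k ≤ ℓ ∙ h
  harmonic-minimal h (h₁ , h₂ , hS) = ≤-by (∑ (λ c → key (place c) * g c))
    -- The last index is `pred size`: a level compares `key q` with `key (suc q)`, and `antitone`
    -- holds only for indices below `size`.
    (abel (ℕ.pred size) key place g (λ c → ℕ.≤-pred (subst (place c ℕ.<_) size-suc (place<size c))) ∑g≡0
      (λ q q< → level q (subst (suc q ℕ.<_) (sym size-suc) (s≤s q<))))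
    decomposition
    where
    h° : Point (Coord n)
    h° = harmonicPoint k
    h°∈H : Harmonic n h°
    h°∈H = rankPoint∈Harmonic first second k
    size-suc : size ≡ suc (ℕ.pred size)
    size-suc = sym (ℕ.suc-pred size ⦃ ℕ.≢-nonZero
      (λ eq → ℕ.n≮0 (subst (place (inj₁ k) ℕ.<_) eq (place<size (inj₁ k)))) ⦄)
    d₁ d₂ : Fin n → ℚ
    d₁ i = h (inj₁ i) - h° (inj₁ i)
    d₂ i = h (inj₂ i) - h° (inj₂ i)
    Σd₁≡0 : Σℚ n d₁ ≡ 0ℚ
    Σd₁≡0 = trans (Σ-- (h ∘ inj₁) (h° ∘ inj₁)) (p≡q⇒p-q≡0 (trans h₁ (sym (proj₁ h°∈H))))
    Σd₂≡0 : Σℚ n d₂ ≡ 0ℚ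
    Σd₂≡0 = trans (Σ-- (h ∘ inj₂) (h° ∘ inj₂)) (p≡q⇒p-q≡0 (trans h₂ (sym (proj₁ (proj₂ h°∈H)))))
    -- Since `d₂` sums to 0, its coefficients ℓ(y_i) may be lowered by m, which turns each into
    -- minus the key of the bar of i. The sign is moved into g.
    g : Coord n → ℚ
    g (inj₁ i) = d₁ i
    g (inj₂ i) = (- 1ℚ) * d₂ i
    ∑g≡0 : ∑ g ≡ 0ℚ
    ∑g≡0 = cong₂ _+_ Σd₁≡0 (trans (Σ-*ˡ (- 1ℚ) d₂) (cong ((- 1ℚ) *_) Σd₂≡0))

    decomposition : ℓ ∙ h ≡ ℓ ∙ h° + ∑ (λ c → key (place c) * g c)
    decomposition = begin
      ℓ ∙ h
        ≡⟨ ((∀ a b → a ≡ b + (a - b)) ∋ solve-∀ ℚ-ring) (ℓ ∙ h) (ℓ ∙ h°) ⟩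
      ℓ ∙ h° + (ℓ ∙ h - ℓ ∙ h°)
        ≡⟨ cong (ℓ ∙ h° +_) (trans (sym (∑-- (λ c → ℓ c * h c) (λ c → ℓ c * h° c)))
             (((∀ x y m z → z ≡ 0ℚ → x + y ≡ (x + y) - m * z) ∋ λ x y m z eq → sym
               (trans (cong (λ t → (x + y) - m * t) eq) (((∀ s m → s - m * 0ℚ ≡ s) ∋ solve-∀ ℚ-ring) (x + y) m)))
               (Σℚ n (λ i → ℓ (inj₁ i) * h (inj₁ i) - ℓ (inj₁ i) * h° (inj₁ i)))
                 (Σℚ n (λ i → ℓ (inj₂ i) * h (inj₂ i) - ℓ (inj₂ i) * h° (inj₂ i))) m (Σℚ n d₂) Σd₂≡0)) ⟩
      ℓ ∙ h° + ((x + y) - m * Σℚ n d₂)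
        ≡⟨ cong (ℓ ∙ h° +_) (trans (((∀ x y z → (x + y) - z ≡ x + (y - z)) ∋ solve-∀ ℚ-ring) x y (m * Σℚ n d₂))
             (cong₂ _+_
               (Σ-cong (λ i → trans (((∀ a b c → a * b - a * c ≡ a * (b - c)) ∋ solve-∀ ℚ-ring) (ℓ (inj₁ i))
                 (h (inj₁ i)) (h° (inj₁ i))) (cong (_* d₁ i) (sym (key₁ i)))))
               (trans (cong (λ t → y - t) (sym (Σ-*ˡ m d₂)))
                 (trans (sym (Σ-- (λ i → ℓ (inj₂ i) * h (inj₂ i) - ℓ (inj₂ i) * h° (inj₂ i)) (λ i → m * d₂ i)))
                   (Σ-cong (λ i → trans (((∀ a b c m → (a * b - a * c) - m * (b - c) ≡ (m - a) *
                     ((- 1ℚ) * (b - c))) ∋ solve-∀ ℚ-ring) (ℓ (inj₂ i)) (h (inj₂ i)) (h° (inj₂ i)) m)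
                     (cong (_* g (inj₂ i)) (sym (key₂ i))))))))) ⟩
      ℓ ∙ h° + ∑ (λ c → key (place c) * g c) ∎
      where
      open ≡-Reasoning
      x = Σℚ n (λ i → ℓ (inj₁ i) * h (inj₁ i) - ℓ (inj₁ i) * h° (inj₁ i))
      y = Σℚ n (λ i → ℓ (inj₂ i) * h (inj₂ i) - ℓ (inj₂ i) * h° (inj₂ i))

    module _ (q : ℕ) where
      inS? : ∀ i → Dec (place (inj₁ i) ℕ.< suc q)
      inS? i = place (inj₁ i) ℕ.<? suc q
      inT? : ∀ i → Dec (suc q ℕ.≤ place (inj₂ i))
      inT? i = suc q ℕ.≤? place (inj₂ i)
      -- The word is cut after place q: `S′` holds the elements whose first occurrence is before the
      -- cut, `T′` those whose second occurrence is after it. They cover [n] because first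
      -- occurrences precede second ones.
      S′ T′ : Subset n
      S′ = tabulate (does ∘ inS?)
      T′ = tabulate (does ∘ inT?)
      χS : ∀ i → χ S′ i ≡ ⟦ inS? i ⟧
      χS i = cong (if_then 1ℚ else 0ℚ) (lookup∘tabulate (does ∘ inS?) i)
      χT : ∀ i → χ T′ i ≡ ⟦ inT? i ⟧
      χT i = cong (if_then 1ℚ else 0ℚ) (lookup∘tabulate (does ∘ inT?) i)
      ∈S : ∀ {i} → place (inj₁ i) ℕ.< suc q → i ∈ S′
      ∈S {i} p = lookup⇒[]= i S′ (trans (lookup∘tabulate (does ∘ inS?) i) (dec-true (inS? i) p))
      ∈T : ∀ {i} → suc q ℕ.≤ place (inj₂ i) → i ∈ T′
      ∈T {i} p = lookup⇒[]= i T′ (trans (lookup∘tabulate (does ∘ inT?) i) (dec-true (inT? i) p))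

      G : ℚ
      G = ∑ (λ c → ⟦ place c ℕ.<? suc q ⟧ * g c)

      -- Minus the sum of `d₂` over the bars before the cut is its sum over the bars after it, the
      -- total being 0.
      G≡ : G ≡ Σℚ n (λ i → ⟦ inS? i ⟧ * d₁ i) + Σℚ n (λ i → ⟦ inT? i ⟧ * d₂ i)
      G≡ = cong (Σℚ n (λ i → ⟦ inS? i ⟧ * d₁ i) +_) (trans
        (Σ-cong (λ i → trans (cong (_* ((- 1ℚ) * d₂ i))
          (⟦⟧-complement (place (inj₂ i) ℕ.<? suc q) (inT? i) ℕ.<⇒≱ ℕ.≮⇒≥))
          (((∀ t d → (1ℚ - t) * ((- 1ℚ) * d) ≡ t * d - d) ∋ solve-∀ ℚ-ring) ⟦ inT? i ⟧ (d₂ i))))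
        (trans (Σ-- (λ i → ⟦ inT? i ⟧ * d₂ i) d₂) (trans (cong (λ t → Σℚ n (λ i → ⟦ inT? i ⟧ * d₂ i) - t) Σd₂≡0)
          (((∀ a → a - 0ℚ ≡ a) ∋ solve-∀ ℚ-ring) (Σℚ n (λ i → ⟦ inT? i ⟧ * d₂ i))))))

      G≡difference : G ≡ (sumOver S′ (h ∘ inj₁) + sumOver T′ (h ∘ inj₂)) -
        (sumOver S′ (h° ∘ inj₁) + sumOver T′ (h° ∘ inj₂))
      G≡difference = trans G≡ (trans (cong₂ _+_ (split (⟦_⟧ ∘ inS?) S′ χS (h ∘ inj₁) (h° ∘ inj₁))
        (split (⟦_⟧ ∘ inT?) T′ χT (h ∘ inj₂) (h° ∘ inj₂)))
        (((∀ a b c d → (a - b) + (c - d) ≡ (a + c) - (b + d)) ∋ solve-∀ ℚ-ring) (sumOver S′ (h ∘ inj₁))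
          (sumOver S′ (h° ∘ inj₁)) (sumOver T′ (h ∘ inj₂)) (sumOver T′ (h° ∘ inj₂))))
        where
        split : ∀ f U → (∀ i → χ U i ≡ f i) → ∀ (a b : Fin n → ℚ) → Σℚ n
          (λ i → f i * (a i - b i)) ≡ sumOver U a - sumOver U b
        split f U eq a b = trans (Σ-cong (λ i → trans (cong (_* (a i - b i)) (sym (eq i)))
          (((∀ f a b → f * (a - b) ≡ f * a - f * b) ∋ solve-∀ ℚ-ring) (χ U i) (a i) (b i))))
          (trans (Σ-- (λ i → χ U i * a i) (λ i → χ U i * b i)) (sym (cong₂ _-_ (sumOver-χ U a) (sumOver-χ U b))))

      -- `S′` is an initial segment for `first` and `T′` for `second`, so the ranks sum to
      -- triangular numbers; k lies in at most one of the two sets and adds at most 1.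
      tight : ¬ (place (inj₁ k) ℕ.< suc q × suc q ℕ.≤ place (inj₂ k)) →
        2ℚ * (sumOver S′ (h° ∘ inj₁) + sumOver T′ (h° ∘ inj₂)) ≤
        ((ι ∣ S′ ∣ * ι ∣ S′ ∣ + ι ∣ S′ ∣) + (ι ∣ T′ ∣ * ι ∣ T′ ∣ + ι ∣ T′ ∣)) + 2ℚ
      tight separated = ≤-trans (≤-reflexive (trans (*-distribˡ-+ 2ℚ (sumOver S′ (h° ∘ inj₁)) (sumOver T′ (h° ∘ inj₂)))
          (trans (cong₂ _+_ (side first (⟦_⟧ ∘ inS?) S′ χS (λ i → ⟦⟧-idem (inS? i))
            (λ i j → ⟦⟧-absorb (inS? i) (inS? j) (place (inj₁ j) ℕ.<? place (inj₁ i)) (λ p r → ℕ.<-trans r p)))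
                            (side second (⟦_⟧ ∘ inT?) T′ χT (λ i → ⟦⟧-idem (inT? i))
                              (λ i j → ⟦⟧-absorb (inT? i) (inT? j) (place (inj₂ i) ℕ.<? place (inj₂ j))
                                (λ p r → ℕ.≤-trans p (ℕ.<⇒≤ r)))))
            (((∀ a b c d → (a + 2ℚ * c) + (b + 2ℚ * d) ≡ (a + b) + 2ℚ * (c + d)) ∋ solve-∀ ℚ-ring)
               (ι ∣ S′ ∣ * ι ∣ S′ ∣ + ι ∣ S′ ∣) (ι ∣ T′ ∣ * ι ∣ T′ ∣ + ι ∣ T′ ∣) ⟦ inS? k ⟧ ⟦ inT? k ⟧))))
        (+-monoʳ-≤ ((ι ∣ S′ ∣ * ι ∣ S′ ∣ + ι ∣ S′ ∣) + (ι ∣ T′ ∣ * ι ∣ T′ ∣ + ι ∣ T′ ∣))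
          (*-monoˡ-nonneg 0≤2 (⟦⟧-exclusive (inS? k) (inT? k) (λ a b → separated (a , b)))))
        where
        side : ∀ (P : Tournament n) f U → (∀ i → χ U i ≡ f i) → Idempotent f →
          (∀ i j → f i * Tournament.beats P j i ≡ f i * (f j * Tournament.beats P j i)) →
          2ℚ * sumOver U (λ i → Tournament.rank P i + δ i k) ≡ (ι ∣ U ∣ * ι ∣ U ∣ + ι ∣ U ∣) + 2ℚ * f k
        side P f U eq idem closed = trans (cong (2ℚ *_)
          (trans (sumOver-χ U (λ i → Tournament.rank P i + δ i k))
            (Σ-cong (λ i → cong (_* (Tournament.rank P i + δ i k)) (eq i)))))
          (trans (rank-sum-shift P k f) (cong (_+ 2ℚ * f k) (trans (rank-sum-≡ P f idem closed)
            (cong (λ s → s * s + s) (trans (sym (Σ-cong eq)) (Σ-χ U))))))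

      -- If one of `S′`, `T′` is empty, the other is everything and G is the full sum of `d₂` or
      -- `d₁`, that is 0. Otherwise they form a bisubset, as k is missing from one of them.
      G-nonneg : ¬ (place (inj₁ k) ℕ.< suc q × suc q ℕ.≤ place (inj₂ k)) → 0ℚ ≤ G
      G-nonneg separated with Fin.any? inS? | Fin.any? inT?
      ... | no ∄S | _ = ≤-reflexive (sym (trans G≡ (cong₂ _+_
            (Σ-zero (λ i → trans (cong (_* d₁ i) (⟦⟧-false (inS? i) (λ p → ∄S (i , p)))) (*-zeroˡ (d₁ i))))
            (trans (Σ-cong (λ i → trans (cong (_* d₂ i)
              (⟦⟧-true (inT? i) (ℕ.<⇒≤ (ℕ.≤-<-trans (ℕ.≮⇒≥ (λ p → ∄S (i , p))) (ordered i)))))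
                (*-identityˡ (d₂ i)))) Σd₂≡0))))
      ... | yes _ | no ∄T = ≤-reflexive (sym (trans G≡ (cong₂ _+_
            (trans (Σ-cong (λ i → trans (cong (_* d₁ i)
              (⟦⟧-true (inS? i) (ℕ.<-trans (ordered i) (ℕ.≰⇒> (λ p → ∄T (i , p)))))) (*-identityˡ (d₁ i)))) Σd₁≡0)
            (Σ-zero (λ i → trans (cong (_* d₂ i) (⟦⟧-false (inT? i) (λ p → ∄T (i , p)))) (*-zeroˡ (d₂ i)))))))
      ... | yes (i , i∈S) | yes (j , j∈T) = subst (0ℚ ≤_) (sym G≡difference) (p≤q⇒0≤q-p
            (≤-trans (halve-≤ (≤-trans (tight separated) (≤-reflexive (sym (bisubset-bound ∣ S′ ∣ ∣ T′ ∣)))))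
              (hS S′ T′ bisubset)))
        where
        covering : ∀ {x} → x ∈ S′ ∪ T′
        covering {x} with inS? x
        ... | yes x∈S = x∈p∪q⁺ (inj₁ (∈S x∈S))
        ... | no x∉S  = x∈p∪q⁺ {p = S′} (inj₂ (∈T (ℕ.<⇒≤ (ℕ.≤-<-trans (ℕ.≮⇒≥ x∉S) (ordered x)))))
        member : ∀ {U} {a : Fin n → Set} (a? : ∀ i → Dec (a i)) → (∀ i → χ U i ≡ ⟦ a? i ⟧) → U ≡ ⊤ → a k
        member a? eq refl with a? k in e
        ... | yes p = p
        ... | no _  = ⊥-elim (1≢0 (trans (sym (χ-∈ (∈⊤ {x = k}))) (trans (eq k) (cong ⟦_⟧ e))))
        bisubset : IsBisubset S′ T′
        bisubset = (i , ∈S i∈S) , (j , ∈T j∈T) , ⊆-antisym ⊆⊤ (λ _ → covering) ,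
          (λ (S≡⊤ , T≡⊤) → separated (member inS? χS S≡⊤ , member inT? χT T≡⊤))

      -- When k is in both sets, q and q + 1 lie between the places of k and of its bar. The keys
      -- agree at these two ends, so they do not drop at the cut.
      level : suc q ℕ.< size → 0ℚ ≤ (key q - key (suc q)) * G
      level q<size with inS? k | inT? k
      ... | yes k∈S | yes k∈T = ≤-reflexive (sym (trans (cong (_* G) gap≡0) (*-zeroˡ G)))
        where
        keys≡ : key (place (inj₁ k)) ≡ key (place (inj₂ k))
        keys≡ = trans (key₁ k) (trans (((∀ a b → a ≡ (a + b) - b) ∋ solve-∀ ℚ-ring) (ℓ (inj₁ k)) (ℓ (inj₂ k)))
          (sym (key₂ k)))
        gap≡0 : key q - key (suc q) ≡ 0ℚ
        gap≡0 = trans (cong (_- key (suc q)) (≤-antisym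
          (≤-trans (antitone (ℕ.≤-pred k∈S) (ℕ.<-trans (ℕ.n<1+n q) q<size))
            (≤-trans (≤-reflexive keys≡) (antitone k∈T (place<size (inj₂ k)))))
          (antitone (ℕ.n≤1+n q) q<size))) (+-inverseʳ (key (suc q)))
      ... | no k∉S | _      = *-nonneg (p≤q⇒0≤q-p (antitone (ℕ.n≤1+n q) q<size)) (G-nonneg (k∉S ∘ proj₁))
      ... | yes _  | no k∉T = *-nonneg (p≤q⇒0≤q-p (antitone (ℕ.n≤1+n q) q<size)) (G-nonneg (k∉T ∘ proj₂))

-- Sorting

minimum : ∀ {n} (f : Fin (suc n) → ℚ) → ∃[ k ] ∀ i → f k ≤ f i
minimum {zero}  f = zero , λ { zero → ≤-refl }
minimum {suc n} f with minimum (f ∘ suc)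
... | k , least with ≤-total (f zero) (f (suc k))
...   | inj₁ f0≤ = zero , λ { zero → ≤-refl ; (suc i) → ≤-trans f0≤ (least i) }
...   | inj₂ ≤f0 = suc k , λ { zero → ≤f0 ; (suc i) → least i }

count-↭ : ∀ {n} (i : Fin n) {xs ys} → xs ↭ ys → count i xs ≡ count i ys
count-↭ i Perm.refl = refl
count-↭ i (Perm.prep x p) with does (i Fin.≟ x)
... | true  = cong suc (count-↭ i p)
... | false = count-↭ i p
count-↭ i (Perm.swap x y p) with does (i Fin.≟ x) | does (i Fin.≟ y)
... | true  | true  = cong (2 ℕ.+_) (count-↭ i p)
... | true  | false = cong suc (count-↭ i p)
... | false | true  = cong suc (count-↭ i p)
... | false | false = count-↭ i p
count-↭ i (Perm.trans p q) = trans (count-↭ i p) (count-↭ i q)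

count-++ : ∀ {n} (i : Fin n) xs ys → count i (xs ++ ys) ≡ count i xs ℕ.+ count i ys
count-++ i []       ys = refl
count-++ i (x ∷ xs) ys with does (i Fin.≟ x)
... | true  = cong suc (count-++ i xs ys)
... | false = count-++ i xs ys

count-absent : ∀ {n} (i : Fin n) {m} (f : Fin m → Fin n) → (∀ j → i ≢ f j) → count i (List.tabulate f) ≡ 0
count-absent i {zero}  f i≢ = refl
count-absent i {suc m} f i≢ rewrite dec-false (i Fin.≟ f zero) (i≢ zero) = count-absent i (f ∘ suc) (i≢ ∘ suc)

count-image : ∀ {n m} (f : Fin m → Fin n) → (∀ {i j} → f i ≡ f j → i ≡ j) → ∀ j → count (f j) (List.tabulate f) ≡ 1
count-image f inj zero rewrite dec-true (f zero Fin.≟ f zero) refl =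
  cong suc (count-absent (f zero) (f ∘ suc) (λ j eq → Fin.0≢1+n (inj eq)))
count-image f inj (suc j) rewrite dec-false (f (suc j) Fin.≟ f zero) (Fin.0≢1+n ∘ sym ∘ inj) =
  count-image (f ∘ suc) (Fin.suc-injective ∘ inj) j

-- The default 0 past the end need not fit a decreasing sequence, hence the bounds by the length
-- below.
keyAt : ∀ {n} → (Letter n → ℚ) → List (Letter n) → ℕ → ℚ
keyAt κ []      _       = 0ℚ
keyAt κ (l ∷ w) zero    = κ l
keyAt κ (l ∷ w) (suc p) = keyAt κ w p

Decreasing : ∀ {n} → (Letter n → ℚ) → List (Letter n) → Set
Decreasing κ = AllPairs (λ l l′ → κ l′ ≤ κ l)

keyAt-≤ : ∀ {n} (κ : Letter n → ℚ) {x w} q → All (λ l → κ l ≤ x) w → q ℕ.< length w → keyAt κ w q ≤ x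
keyAt-≤ κ zero    (p ∷ ps) q< = p
keyAt-≤ κ (suc q) (p ∷ ps) (s≤s q<) = keyAt-≤ κ q ps q<

keyAt-antitone : ∀ {n} (κ : Letter n → ℚ) {w} → Decreasing κ w → ∀ {p q} → p ℕ.≤ q → q ℕ.< length w →
  keyAt κ w q ≤ keyAt κ w p
keyAt-antitone κ (_ ∷ _)  {zero} {zero}  _ _ = ≤-refl
keyAt-antitone κ (d ∷ _)  {zero} {suc q} _ (s≤s q<) = keyAt-≤ κ q d q<
keyAt-antitone κ (_ ∷ ds) (s≤s p≤q) (s≤s q<) = keyAt-antitone κ ds p≤q q<

keyAt-position : ∀ {n} (κ : Letter n → ℚ) l w → position l w ℕ.< length w → keyAt κ w (position l w) ≡ κ l
keyAt-position κ (i , β) ((j , γ) ∷ w) p< with does (i Fin.≟ j) ∧ does (β Bool≟ γ) in m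
... | true  = cong κ (sym (match⇒≡ i j β γ m))
... | false = keyAt-position κ (i , β) w (ℕ.≤-pred p<)

module _ {n} (k : Fin n) where

  -- A bipermutation records only labels, so a sorted list of letters must be shown to come back
  -- from its labels. The single letter of k comes back as the pair that `wordFrom` writes for it.
  expand : List (Letter n) → List (Letter n)
  expand [] = []
  expand (l ∷ ls) with proj₁ l Fin.≟ k
  ... | yes _ = (k , false) ∷ (k , true) ∷ expand ls
  ... | no _  = l ∷ expand ls

  -- The hypotheses are the invariant of `wordFrom`: plain letters still to come are unseen, a
  -- barred letter has its partner in `seen` or in the list, and no bar precedes its partner. So the
  -- test against `seen` restores each bar.
  word-expand : ∀ seen ls →
    (∀ {i} → i ≢ k → (i , false) ∈ₗ ls → memb i seen ≡ false) →
    (∀ {i} → (i , true) ∈ₗ ls → i ≢ k × (memb i seen ≡ true ⊎ (i , false) ∈ₗ ls)) →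
    Unique ls → AllPairs (λ l l′ → ∀ i → l ≡ (i , true) → l′ ≢ (i , false)) ls →
    wordFrom k seen (map proj₁ ls) ≡ expand ls
  word-expand seen [] _ _ _ _ = refl
  word-expand seen ((i , β) ∷ ls) new partner (fresh ∷ uniq) (order ∷ orders) with i Fin.≟ k
  ... | yes refl = cong (λ w → (k , false) ∷ (k , true) ∷ w)
        (word-expand seen ls (λ j≢k → new j≢k ∘ there) partner′ uniq orders)
    where
    partner′ : ∀ {j} → (j , true) ∈ₗ ls → j ≢ k × (memb j seen ≡ true ⊎ (j , false) ∈ₗ ls)
    partner′ j∈ with partner (there j∈)
    ... | j≢k , inj₁ s            = j≢k , inj₁ s
    ... | j≢k , inj₂ (there p)    = j≢k , inj₂ p
    ... | j≢k , inj₂ (here refl)  = ⊥-elim (j≢k refl)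
  word-expand seen ((i , false) ∷ ls) new partner (fresh ∷ uniq) (order ∷ orders) | no i≢k
    rewrite new i≢k (here refl) =
    cong ((i , false) ∷_) (word-expand (i ∷ seen) ls new′ partner′ uniq orders)
    where
    new′ : ∀ {j} → j ≢ k → (j , false) ∈ₗ ls → memb j (i ∷ seen) ≡ false
    new′ {j} j≢k j∈ rewrite dec-false (j Fin.≟ i) (λ { refl → All.lookup fresh j∈ refl }) = new j≢k (there j∈)
    partner′ : ∀ {j} → (j , true) ∈ₗ ls → j ≢ k × (memb j (i ∷ seen) ≡ true ⊎ (j , false) ∈ₗ ls)
    partner′ {j} j∈ with j Fin.≟ i | partner (there j∈)
    ... | yes _   | j≢k , _                = j≢k , inj₁ refl
    ... | no _    | j≢k , inj₁ s           = j≢k , inj₁ s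
    ... | no j≢i  | _   , inj₂ (here refl) = ⊥-elim (j≢i refl)
    ... | no _    | j≢k , inj₂ (there p)   = j≢k , inj₂ p
  word-expand seen ((i , true) ∷ ls) new partner (fresh ∷ uniq) (order ∷ orders) | no i≢k =
    trans (cong (if_then (i , true) ∷ wordFrom k seen (map proj₁ ls) else
      ((i , false) ∷ wordFrom k (i ∷ seen) (map proj₁ ls))) seen-i)
      (cong ((i , true) ∷_) (word-expand seen ls (λ j≢k → new j≢k ∘ there) partner′ uniq orders))
    where
    seen-i : memb i seen ≡ true
    seen-i with partner (here refl)
    ... | _ , inj₁ s         = s
    ... | _ , inj₂ (there p) = ⊥-elim (All.lookup order p i refl refl)
    partner′ : ∀ {j} → (j , true) ∈ₗ ls → j ≢ k × (memb j seen ≡ true ⊎ (j , false) ∈ₗ ls)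
    partner′ j∈ with partner (there j∈)
    ... | j≢k , inj₁ s         = j≢k , inj₁ s
    ... | j≢k , inj₂ (there p) = j≢k , inj₂ p

  module _ (κ : Letter n → ℚ) (tie : κ (k , false) ≡ κ (k , true)) where

    expand-All : ∀ {x ls} → All (λ l → κ l ≤ x) ls → All (λ l → κ l ≤ x) (expand ls)
    expand-All [] = []
    expand-All {ls = (i , β) ∷ ls} (p ∷ ps) with i Fin.≟ k
    ... | no _ = p ∷ expand-All ps
    expand-All {ls = (i , false) ∷ ls} (p ∷ ps) | yes refl = p ∷ subst (_≤ _) tie p ∷ expand-All ps
    expand-All {ls = (i , true) ∷ ls}  (p ∷ ps) | yes refl = subst (_≤ _) (sym tie) p ∷ p ∷ expand-All ps

    expand-decreasing : ∀ {ls} → Decreasing κ ls → Decreasing κ (expand ls)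
    expand-decreasing [] = []
    expand-decreasing {(i , β) ∷ ls} (d ∷ ds) with i Fin.≟ k
    ... | no _ = expand-All d ∷ expand-decreasing ds
    expand-decreasing {(i , false) ∷ ls} (d ∷ ds) | yes refl =
      (≤-reflexive (sym tie) ∷ expand-All d) ∷ subst (λ x → All (λ l → κ l ≤ x) (expand ls)) tie
        (expand-All d) ∷ expand-decreasing ds
    expand-decreasing {(i , true) ∷ ls} (d ∷ ds) | yes refl =
      (≤-reflexive (sym tie) ∷ subst (λ x → All (λ l → κ l ≤ x) (expand ls)) (sym tie)
        (expand-All d)) ∷ expand-All d ∷ expand-decreasing ds

module Sorting {n} (k : Fin (suc n)) (κ : Letter (suc n) → ℚ)
  (tie : κ (k , false) ≡ κ (k , true)) (descent : ∀ i → κ (i , true) ≤ κ (i , false)) where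

  -- Decreasing keys, ties broken by plain before barred. The tie-break matters for every i with
  -- ℓ(x_i) + ℓ(y_i) = m, whose two letters have equal keys; a bar must not overtake its letter
  -- there.
  order : DecTotalOrder _ _ _
  order = On.decTotalOrder (×-decTotalOrder (Flip.decTotalOrder ≤-decTotalOrder) Bool.≤-decTotalOrder)
    (λ l → κ l , proj₂ l)

  plain : Fin (suc n) → Letter (suc n)
  plain i = i , false
  -- `punchIn k` skips k, which must be listed once; its bar is written by `wordFrom`.
  overlined : Fin n → Letter (suc n)
  overlined j = punchIn k j , true

  unbarred barred letters : List (Letter (suc n))
  unbarred = List.tabulate plain
  barred   = List.tabulate overlined
  letters  = unbarred ++ barred

  open Sort order using (sort; sort-↭; sort-↗)

  list : List (Letter (suc n))
  list = sort letters

  labels : List (Fin (suc n))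
  labels = map proj₁ list

  letters-labels : map proj₁ letters ≡ List.tabulate id ++ List.tabulate (punchIn k)
  letters-labels = trans (map-++ proj₁ unbarred barred)
    (cong₂ _++_ (map-tabulate plain proj₁) (map-tabulate overlined proj₁))

  count-labels : ∀ i → count i labels ≡ 1 ℕ.+ count i (List.tabulate (punchIn k))
  count-labels i = trans (count-↭ i (Perm.map⁺ proj₁ (sort-↭ letters))) (trans (cong (count i) letters-labels)
    (trans (count-++ i (List.tabulate id) (List.tabulate (punchIn k)))
      (cong (ℕ._+ count i (List.tabulate (punchIn k))) (count-image id id i))))

  bipermutation : IsBipermutation (suc n) labels k
  bipermutation =
    trans (length-map proj₁ list) (trans (Perm.↭-length (sort-↭ letters)) (trans (length-++ unbarred)
      (trans (cong₂ ℕ._+_ (length-tabulate plain) (length-tabulate overlined))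
        (trans (sym (ℕ.+-suc n n)) (cong (λ t → n ℕ.+ suc t) (sym (ℕ.+-identityʳ n))))))) ,
    trans (count-labels k) (cong suc (count-absent k (punchIn k) (λ j → Fin.punchInᵢ≢i k j ∘ sym))) ,
    (λ i i≢k → trans (count-labels i) (cong suc (subst (λ i → count i (List.tabulate (punchIn k)) ≡ 1)
      (Fin.punchIn-punchOut (i≢k ∘ sym)) (count-image (punchIn k) (λ {i} {j} → Fin.punchIn-injective k i j)
        (punchOut (i≢k ∘ sym))))))

  unique : Unique list
  unique = SetoidPerm.Unique-resp-↭ (setoid _) (↭⇒↭ₛ (↭-sym (sort-↭ letters)))
    (Unique.++⁺ (Unique.tabulate⁺ {f = plain} (cong proj₁))
      (Unique.tabulate⁺ {f = overlined} (λ {i} {j} eq → Fin.punchIn-injective k i j (cong proj₁ eq)))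
      (λ (u , b) → disjoint (∈-tabulate⁻ {f = plain} u) (∈-tabulate⁻ {f = overlined} b)))
    where
    disjoint : ∀ {l} → ∃[ i ] l ≡ (i , false) → ¬ (∃[ j ] l ≡ (punchIn k j , true))
    disjoint (_ , refl) (_ , ())

  lex : AllPairs (DecTotalOrder._≤_ order) list
  lex = Sorted⇒AllPairs (DecTotalOrder.totalOrder order) (sort-↗ letters)

  decreasing : Decreasing κ list
  decreasing = AllPairs.map (λ { (inj₁ (le , _)) → le ; (inj₂ (eq , _)) → ≤-reflexive eq }) lex

  bars-follow : AllPairs (λ l l′ → ∀ i → l ≡ (i , true) → l′ ≢ (i , false)) list
  bars-follow = AllPairs.map
    (λ { (inj₁ (le , neq)) i refl refl → neq (≤-antisym le (descent i)) ; (inj₂ (_ , ())) i refl refl }) lex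

  word-decreasing : Decreasing κ (word k labels)
  word-decreasing = subst (Decreasing κ)
    (sym (word-expand k [] list (λ _ _ → refl)
      (λ {i} p → barred⇒≢k (∈-++⁻ unbarred (Perm.∈-resp-↭ (sort-↭ letters) p)) , inj₂
        (Perm.∈-resp-↭ (↭-sym (sort-↭ letters)) (∈-++⁺ˡ (∈-tabulate⁺ {f = plain} i)))) unique bars-follow))
    (expand-decreasing k κ tie decreasing)
    where
    barred⇒≢k : ∀ {i} → (i , true) ∈ₗ unbarred ⊎ (i , true) ∈ₗ barred → i ≢ k
    barred⇒≢k (inj₁ p) with ∈-tabulate⁻ {f = plain} p
    ... | _ , ()
    barred⇒≢k (inj₂ p) with ∈-tabulate⁻ {f = overlined} p
    ... | j , refl = Fin.punchInᵢ≢i k j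

-- Taking for k a minimiser of ℓ(x_i) + ℓ(y_i) yields both hypotheses of `Sorting`: equal keys for k
-- and its bar, and no bar with a larger key than its letter.
sorted-bipermutation : ∀ {n} ⦃ _ : ℕ.NonZero n ⦄ (ℓ : Coord n → ℚ) →
  ∃[ b ] ∃[ k ] Σ (IsBipermutation n b k) λ bip → Sorted (arrangement b k bip) k ℓ
sorted-bipermutation {suc n} ℓ with minimum (λ i → ℓ (inj₁ i) + ℓ (inj₂ i))
... | k , least = labels , k , bipermutation , record
  { key = keyAt κ (word k labels)
  ; antitone = keyAt-antitone κ word-decreasing
  ; key₁ = λ i → keyAt-position κ (i , false) (word k labels) (place<size (inj₁ i))
  ; key₂ = λ i → keyAt-position κ (i , true) (word k labels) (place<size (inj₂ i))
  ; minimal = least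
  }
  where
  κ : Letter (suc n) → ℚ
  κ (i , false) = ℓ (inj₁ i)
  κ (i , true)  = ℓ (inj₁ k) + ℓ (inj₂ k) - ℓ (inj₂ i)
  open Sorting k κ
    (((∀ a b → a ≡ a + b - b) ∋ solve-∀ ℚ-ring) (ℓ (inj₁ k)) (ℓ (inj₂ k)))
    (λ i → ≤-by (ℓ (inj₁ i) + ℓ (inj₂ i) - (ℓ (inj₁ k) + ℓ (inj₂ k))) (p≤q⇒0≤q-p (least i))
      (((∀ a b m → a ≡ (m - b) + (a + b - m)) ∋ solve-∀ ℚ-ring) (ℓ (inj₁ i)) (ℓ (inj₂ i)) (ℓ (inj₁ k) + ℓ (inj₂ k))))
  open Arrangement (arrangement labels k bipermutation) using (place<size)

-- The Minkowski decomposition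

isBipermutation? : ∀ n b k → Dec (IsBipermutation n b k)
isBipermutation? n b k = (length b ℕ.≟ 2 ℕ.* n ℕ.∸ 1) ×-dec ((count k b ℕ.≟ 1) ×-dec
  Fin.all? (λ i → ¬? (i Fin.≟ k) →-dec (count i b ℕ.≟ 2)))

listsOfLength : ∀ n → ℕ → List (List (Fin n))
listsOfLength n zero    = [] ∷ []
listsOfLength n (suc m) = cartesianProductWith _∷_ (allFin n) (listsOfLength n m)

∈-listsOfLength : ∀ {n} (b : List (Fin n)) → b ∈ₗ listsOfLength n (length b)
∈-listsOfLength []      = here refl
∈-listsOfLength (i ∷ b) = ∈-cartesianProductWith⁺ _∷_ (∈-allFin i) (∈-listsOfLength b)

-- A Minkowski summand must be spanned by a finite family, and Farkas' lemma takes finitely many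
-- generators; both families are indexed by this list of all bipermutations.
record Enumeration (n : ℕ) : Set where
  field
    size     : ℕ
    item     : Fin size → List (Fin n) × Fin n
    valid    : ∀ j → IsBipermutation n (proj₁ (item j)) (proj₂ (item j))
    complete : ∀ b k → IsBipermutation n b k → ∃[ j ] (b , k) ≡ item j

abstract
  bipermutations : ∀ n → Enumeration n
  bipermutations n = record
    { size = length found ; item = List.lookup found
    ; valid = λ j → proj₂ (∈-filter⁻ bip? {xs = candidates} (∈-lookup j))
    ; complete = λ b k bip → Any.index (member b k bip) , lookup-index (member b k bip)
    }
    where
    bip? : (bk : List (Fin n) × Fin n) → Dec (IsBipermutation n (proj₁ bk) (proj₂ bk))
    bip? (b , k) = isBipermutation? n b k
    candidates found : List (List (Fin n) × Fin n)
    candidates = cartesianProduct (listsOfLength n (2 ℕ.* n ℕ.∸ 1)) (allFin n)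
    found = filter bip? candidates
    member : ∀ b k → IsBipermutation n b k → (b , k) ∈ₗ found
    member b k bip = ∈-filter⁺ bip? (∈-cartesianProduct⁺
      (subst (λ m → b ∈ₗ listsOfLength n m) (proj₁ bip) (∈-listsOfLength b)) (∈-allFin k)) bip

module _ {n : ℕ} where
  open Enumeration (bipermutations n) public

residualOf : ∀ {n} (b : List (Fin n)) k → IsBipermutation n b k → Point (Coord n)
residualOf b k bip = Places.residual (arrangement b k bip) k

harmonicOf : ∀ {n} (b : List (Fin n)) k → IsBipermutation n b k → Point (Coord n)
harmonicOf b k bip = Places.harmonicPoint (arrangement b k bip) k

harmonicOf∈Harmonic : ∀ {n} (b : List (Fin n)) k bip → Harmonic n (harmonicOf b k bip)
harmonicOf∈Harmonic b k bip = rankPoint∈Harmonic first second k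
  where open Places (arrangement b k bip)

arrangementAt : ∀ {n} → Fin size → Arrangement n
arrangementAt j = arrangement (proj₁ (item j)) (proj₂ (item j)) (valid j)

residuals : ∀ n → Fin size → Point (Coord n)
residuals n j = residualOf (proj₁ (item j)) (proj₂ (item j)) (valid j)

residualOf∈image : ∀ {n} b k bip → image (residuals n) (residualOf b k bip)
residualOf∈image {n} b k bip with complete b k bip
... | j , eq = j , same (valid j) eq
  where
  -- The enumeration brings its own validity proof, but the coordinates are computed from the word
  -- alone.
  same : ∀ {b′ k′} bip′ → (b , k) ≡ (b′ , k′) → residualOf b k bip ≐ residualOf b′ k′ bip′
  same bip′ refl (inj₁ i) = refl
  same bip′ refl (inj₂ i) = refl

weighted-const : ∀ {m} (w : Fin m → ℚ) c → Σℚ m w ≡ 1ℚ → Σℚ m (λ j → w j * c) ≡ c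
weighted-const w c Σw≡1 = trans (Σ-*ʳ c w) (trans (cong (_* c) Σw≡1) (*-identityˡ c))

weighted-≥ : ∀ {m} {w : Fin m → ℚ} (f : Fin m → ℚ) c → (∀ j → 0ℚ ≤ w j) → Σℚ m w ≡ 1ℚ → (∀ j → c ≤ f j) → c ≤ Σℚ m
  (λ j → w j * f j)
weighted-≥ {m} {w} f c w≥0 Σw≡1 c≤f = subst (_≤ Σℚ m (λ j → w j * f j)) (weighted-const w c Σw≡1)
  (Σ-mono (λ j → *-monoˡ-nonneg (w≥0 j) (c≤f j)))

Harmonic-convex : ∀ {n m} (h : Fin m → Point (Coord n)) x → (∀ j → Harmonic n (h j)) → IsConvComb m h x → Harmonic n x
Harmonic-convex {n} {m} h x h∈H (w , w≥0 , Σw≡1 , eq) =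
  average {g = λ j → h j ∘ inj₁} (λ e → eq (inj₁ e)) (λ j → proj₁ (h∈H j)) ,
  average {g = λ j → h j ∘ inj₂} (λ e → eq (inj₂ e)) (λ j → proj₁ (proj₂ (h∈H j))) ,
  λ S T bis → ≤-trans (weighted-≥ (λ j → sumOver S (h j ∘ inj₁) + sumOver T (h j ∘ inj₂)) _ w≥0 Σw≡1
    (λ j → proj₂ (proj₂ (h∈H j)) S T bis))
    (≤-reflexive (trans (Σ-cong (λ j → *-distribˡ-+ (w j) (sumOver S (h j ∘ inj₁)) (sumOver T (h j ∘ inj₂))))
      (trans (Σ-+ (λ j → w j * sumOver S (h j ∘ inj₁)) (λ j → w j * sumOver T (h j ∘ inj₂)))
        (sym (cong₂ _+_ (sumOver-comb S {g = λ j → h j ∘ inj₁} (λ e → eq (inj₁ e)))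
          (sumOver-comb T {g = λ j → h j ∘ inj₂} (λ e → eq (inj₂ e))))))))
  where
  module N = Summation (finite n)
  average : ∀ {f : Fin n → ℚ} {g : Fin m → Fin n → ℚ} {c} → (∀ e → f e ≡ Σℚ m (λ j → w j * g j e)) →
    (∀ j → Σℚ n (g j) ≡ c) → Σℚ n f ≡ c
  average {f} {g} {c} fg Σg≡c = trans (Σ-cong fg) (trans (Σ-swap n m (λ e j → w j * g j e))
    (trans (Σ-cong (λ j → trans (Σ-*ˡ (w j) (g j)) (cong (w j *_) (Σg≡c j)))) (weighted-const w c Σw≡1)))
  sumOver-comb : ∀ S {f : Fin n → ℚ} {g : Fin m → Fin n → ℚ} → (∀ e → f e ≡ Σℚ m (λ j → w j * g j e)) →
    sumOver S f ≡ Σℚ m (λ j → w j * sumOver S (g j))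
  sumOver-comb S {f} {g} fg = trans (sumOver-χ S f) (trans (Σ-cong (λ e → cong (χ S e *_) (fg e)))
    (trans (N.∙-Σ m (χ S) w g) (Σ-cong (λ j → cong (w j *_) (sym (sumOver-χ S (g j)))))))

decomposition : ∀ n ⦃ _ : ℕ.NonZero n ⦄ → 2ℚ ≤ ι n → Bipermutahedron n ≅ₛ
  ((2ℚ ·ₛ Harmonic n) ⊕ conv (image (residuals n)))
decomposition n 2≤n x = ⇒ , ⇐
  where
  ⇒ : Bipermutahedron n x → ((2ℚ ·ₛ Harmonic n) ⊕ conv (image (residuals n))) x
  ⇒ (m , p , V , w , w≥0 , Σw≡1 , eq) =
    (λ i → 2ℚ * Σℚ m (λ j → w j * h j i)) , (λ i → Σℚ m (λ j → w j * r j i)) ,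
    ((λ i → Σℚ m (λ j → w j * h j i)) ,
      Harmonic-convex h _ (λ j → harmonicOf∈Harmonic (proj₁ (V j)) (proj₁ (proj₂ (V j)))
        (proj₁ (proj₂ (proj₂ (V j))))) (w , w≥0 , Σw≡1 , λ _ → refl) ,
      λ _ → refl) ,
    (m , r , (λ j → residualOf∈image (proj₁ (V j)) (proj₁ (proj₂ (V j)))
      (proj₁ (proj₂ (proj₂ (V j))))) , w , w≥0 , Σw≡1 , λ _ → refl) ,
    λ i → trans (eq i) (trans (Σ-cong (λ j → trans
      (cong (w j *_) (trans (proj₂ (proj₂ (proj₂ (V j))) i)
        (vertex-decomposition (proj₁ (V j)) (proj₁ (proj₂ (V j))) (proj₁ (proj₂ (proj₂ (V j)))) i)))
        (((∀ w h r → w * (2ℚ * h + r) ≡ 2ℚ * (w * h) + w * r) ∋ solve-∀ ℚ-ring) (w j) (h j i) (r j i))))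
      (trans (Σ-+ (λ j → 2ℚ * (w j * h j i)) (λ j → w j * r j i))
        (cong (_+ Σℚ m (λ j → w j * r j i)) (Σ-*ˡ 2ℚ (λ j → w j * h j i)))))
    where
    h r : Fin m → Point (Coord n)
    h j = harmonicOf (proj₁ (V j)) (proj₁ (proj₂ (V j))) (proj₁ (proj₂ (proj₂ (V j))))
    r j = residualOf (proj₁ (V j)) (proj₁ (proj₂ (V j))) (proj₁ (proj₂ (proj₂ (V j))))

  ⇐ : ((2ℚ ·ₛ Harmonic n) ⊕ conv (image (residuals n))) x → Bipermutahedron n x
  ⇐ (s , t , (h , h∈H , s≡2h) , (m , q , q∈ , w , w≥0 , Σw≡1 , t≡) , x≡s+t) =
    size , p , (λ j → proj₁ (item j) , proj₂ (item j) , valid j , λ _ → refl) ,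
    conv-by-support (coords n) p x support
    where
    p : Fin size → Point (Coord n)
    p j = vertex n (proj₁ (item j)) (proj₂ (item j))
    ∙-sum : ∀ (ℓ y a b : Point (Coord n)) → (∀ i → y i ≡ 2ℚ * a i + b i) → ℓ ∙ y ≡ ℓ ∙ b + 2ℚ * ℓ ∙ a
    ∙-sum ℓ y a b eq = trans (∑-cong (λ i → cong (ℓ i *_) (trans (eq i) (+-comm (2ℚ * a i) (b i))))) (∙-linʳ ℓ b 2ℚ a)
    vertex-≤ : ∀ ℓ b k bip → Sorted (arrangement b k bip) k ℓ → ℓ ∙ vertex n b k ≤ ℓ ∙ x
    vertex-≤ ℓ b k bip sorted = subst₂ _≤_
      (sym (∙-sum ℓ (vertex n b k) (harmonicOf b k bip) (residualOf b k bip) (vertex-decomposition b k bip)))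
      (sym (∙-sum ℓ x h t (λ i → trans (x≡s+t i) (cong (_+ t i) (s≡2h i)))))
      (+-mono-≤ residual-≤ (*-monoˡ-nonneg 0≤2 (harmonic-minimal sorted h h∈H)))
      where
      residual-≤ : ℓ ∙ residualOf b k bip ≤ ℓ ∙ t
      residual-≤ = subst (ℓ ∙ residualOf b k bip ≤_)
        (sym (trans (∑-cong (λ i → cong (ℓ i *_) (t≡ i))) (∙-Σ m ℓ w q)))
        (weighted-≥ (λ a → ℓ ∙ q a) (ℓ ∙ residualOf b k bip) w≥0 Σw≡1 (λ a → ≤-trans
          (residual-minimal sorted 2≤n (arrangementAt (proj₁ (q∈ a))) (proj₂ (item (proj₁ (q∈ a)))))
          (≤-reflexive (∑-cong (λ i → cong (ℓ i *_) (sym (proj₂ (q∈ a) i)))))))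
    support : ∀ ℓ → ∃[ j ] ℓ ∙ p j ≤ ℓ ∙ x
    support ℓ = let (b , k , bip , sorted) = sorted-bipermutation ℓ
                    (j , eq) = complete b k bip
                in j , subst (λ bk → ℓ ∙ vertex n (proj₁ bk) (proj₂ bk) ≤ ℓ ∙ x) eq (vertex-≤ ℓ b k bip sorted)

-- The upper bound

3ℚ : ℚ
3ℚ = ℤ.+ 3 / 1

-- Two coordinates whose joint minimum exceeds the sum of their minima by one on the harmonic polytope
-- but not at all on the residual summand.
record TightPair (n : ℕ) : Set where
  field
    c₁ c₂  : Coord n
    ≥1₁    : ∀ h → Harmonic n h → 1ℚ ≤ h c₁
    ≥1₂    : ∀ h → Harmonic n h → 1ℚ ≤ h c₂
    ≥3     : ∀ h → Harmonic n h → 3ℚ ≤ h c₁ + h c₂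
    h₁ h₂  : Point (Coord n)
    h₁∈H   : Harmonic n h₁
    h₂∈H   : Harmonic n h₂
    h₁-c₁  : h₁ c₁ ≡ 1ℚ
    h₁-c₂  : h₁ c₂ ≡ 2ℚ
    h₂-c₂  : h₂ c₂ ≡ 1ℚ
    b      : List (Fin n)
    k      : Fin n
    bip    : IsBipermutation n b k
    r-c₁   : residualOf b k bip c₁ ≡ - (2ℚ * ι n + 1ℚ)
    r-c₂   : residualOf b k bip c₂ ≡ - (2ℚ * ι n + 1ℚ)

-- Let κ = -(2n + 1). Both coordinates are at least 2 + κ on Π, and x = 2h₁ + r has coordinate sum 6
-- + 2κ. Write x = μh + t. Replacing h by h₁ or h₂ with the same t stays in Π, so t is at least 2 +
-- κ - μ at `c₁` and at `c₂`. Hence 6 + 2κ ≥ 3μ + 2(2 + κ - μ), which is μ ≤ 2.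
quotient≤2 : ∀ {n} ⦃ _ : ℕ.NonZero n ⦄ → 2ℚ ≤ ι n → TightPair n → ∀ μ → 0ℚ ≤ μ → IsMinkowskiSummand μ (Harmonic n)
  (Bipermutahedron n) → μ ≤ 2ℚ
quotient≤2 {n} 2≤n tight μ 0≤μ (_ , ρ , Π≅) = conclude (proj₁ (Π≅ x) x∈Π)
  where
  open TightPair tight
  r : Point (Coord n)
  r = residualOf b k bip
  κ : ℚ
  κ = - (2ℚ * ι n + 1ℚ)
  x : Point (Coord n)
  x c = 2ℚ * h₁ c + r c
  single : IsConvComb 1 (λ _ → r) r
  single = (λ _ → 1ℚ) , (λ _ → 0≤1) , refl , λ i → ((∀ a → a ≡ 1ℚ * a + 0ℚ) ∋ solve-∀ ℚ-ring) (r i)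
  x∈Π : Bipermutahedron n x
  x∈Π = proj₂ (decomposition n 2≤n x) ((λ c → 2ℚ * h₁ c) , r , (h₁ , h₁∈H , λ _ → refl) ,
    (1 , (λ _ → r) , (λ _ → residualOf∈image b k bip) , single) , λ _ → refl)
  lower′ : ∀ {y} → ((2ℚ ·ₛ Harmonic n) ⊕ conv (image (residuals n))) y → ∀ c → (∀ h → Harmonic n h → 1ℚ ≤ h c) →
    2ℚ + κ ≤ y c
  lower′ (s , t , (h , h∈H , s≡2h) , (m , q , q∈ , w , w≥0 , Σw≡1 , t≡) , y≡s+t) c ≥1 =
    subst (2ℚ + κ ≤_) (sym (trans (y≡s+t c) (cong₂ _+_ (s≡2h c) (t≡ c))))
      (+-mono-≤ (*-monoˡ-nonneg 0≤2 (≥1 h h∈H))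
        (weighted-≥ (λ j → q j c) κ w≥0 Σw≡1 (λ j → subst (κ ≤_) (sym (proj₂ (q∈ j) c))
        (Places.residual-≥ (arrangementAt (proj₁ (q∈ j))) (proj₂ (item (proj₁ (q∈ j)))) 2≤n c))))
  lower : ∀ {y} → Bipermutahedron n y → ∀ c → (∀ h → Harmonic n h → 1ℚ ≤ h c) → 2ℚ + κ ≤ y c
  lower {y} y∈Π = lower′ (proj₁ (decomposition n 2≤n y) y∈Π)
  conclude : ((μ ·ₛ Harmonic n) ⊕ conv (image ρ)) x → μ ≤ 2ℚ
  conclude (s , t , (h , h∈H , s≡μh) , t∈ , x≡s+t) =
    ≤-by (e₁ + e₂ + μ * (h c₁ + h c₂ - 3ℚ))
      (+-nonneg (+-nonneg (e≥0 h₁ h₁∈H c₁ ≥1₁ h₁-c₁) (e≥0 h₂ h₂∈H c₂ ≥1₂ h₂-c₂)) (*-nonneg 0≤μ (p≤q⇒0≤q-p (≥3 h h∈H))))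
      (sym (trans (((∀ μ t₁ t₂ g₁ g₂ κ → μ + ((μ * 1ℚ + t₁ - (2ℚ + κ)) + (μ * 1ℚ + t₂ - (2ℚ + κ)) + μ * (g₁ + g₂ - 3ℚ))
             ≡ (μ * g₁ + t₁) + (μ * g₂ + t₂) - (2ℚ + κ) - (2ℚ + κ)) ∋ solve-∀ ℚ-ring) μ (t c₁) (t c₂) (h c₁) (h c₂) κ)
        (trans (cong₂ (λ a b → a + b - (2ℚ + κ) - (2ℚ + κ)) (value c₁ h₁-c₁ r-c₁) (value c₂ h₁-c₂ r-c₂))
          (((∀ κ → (2ℚ * 1ℚ + κ) + (2ℚ * 2ℚ + κ) - (2ℚ + κ) - (2ℚ + κ) ≡ 2ℚ) ∋ solve-∀ ℚ-ring) κ))))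
    where
    e₁ e₂ : ℚ
    e₁ = μ * 1ℚ + t c₁ - (2ℚ + κ)
    e₂ = μ * 1ℚ + t c₂ - (2ℚ + κ)
    value : ∀ c {a} → h₁ c ≡ a → r c ≡ κ → μ * h c + t c ≡ 2ℚ * a + κ
    value c h₁c rc = trans (cong (_+ t c) (sym (s≡μh c))) (trans (sym (x≡s+t c)) (cong₂ (λ a b → 2ℚ * a + b) h₁c rc))
    e≥0 : ∀ g → Harmonic n g → ∀ c → (∀ h → Harmonic n h → 1ℚ ≤ h c) → g c ≡ 1ℚ → 0ℚ ≤ μ * 1ℚ + t c - (2ℚ + κ)
    e≥0 g g∈H c ≥1 gc = p≤q⇒0≤q-p (subst (2ℚ + κ ≤_) (cong (λ a → μ * a + t c) gc)
      (lower (proj₂ (Π≅ (λ i → μ * g i + t i)) ((λ i → μ * g i) , t , (g , g∈H , λ _ → refl) , t∈ , λ _ → refl)) c ≥1))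

-- Tight pairs for n = 2 and for n ≥ 3

sumOver-⊤ : ∀ {n} (f : Fin n → ℚ) → sumOver ⊤ f ≡ Σℚ n f
sumOver-⊤ f = Σ-cong (λ i → cong (if_then f i else 0ℚ) (lookup-replicate i true))

sumOver-⊥ : ∀ {n} (f : Fin n → ℚ) → sumOver ⊥ f ≡ 0ℚ
sumOver-⊥ f = Σ-zero (λ i → cong (if_then f i else 0ℚ) (lookup-replicate i false))

-- The inequality of the bisubset S|[n], from which the fixed sum of all y_e cancels n(n+1)/2 + 1.
partial-sum-≥ : ∀ {n} (S : Subset n) → Nonempty S → S ≢ ⊤ → ∀ h → Harmonic n h →
  ι ∣ S ∣ * ι ∣ S ∣ + ι ∣ S ∣ ≤ 2ℚ * sumOver S (h ∘ inj₁)
partial-sum-≥ {n} S S≠∅@(i , _) S≢⊤ h (_ , Σy , bound) = ≤-by (b - a) (p≤q⇒0≤q-p a≤b)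
  (((∀ s σ n → 2ℚ * σ ≡ s + ((2ℚ * σ + (n * n + n + 2ℚ)) - ((s + (n * n + n)) + 2ℚ))) ∋ solve-∀ ℚ-ring)
    (ι ∣ S ∣ * ι ∣ S ∣ + ι ∣ S ∣) (sumOver S (h ∘ inj₁)) (ι n))
  where
  a b : ℚ
  a = ((ι ∣ S ∣ * ι ∣ S ∣ + ι ∣ S ∣) + (ι n * ι n + ι n)) + 2ℚ
  b = 2ℚ * sumOver S (h ∘ inj₁) + (ι n * ι n + ι n + 2ℚ)
  a≤b : a ≤ b
  a≤b = subst₂ _≤_
    (trans (bisubset-bound ∣ S ∣ ∣ ⊤ {n} ∣) (cong (λ m → ((ι ∣ S ∣ * ι ∣ S ∣ + ι ∣ S ∣) + (ι m * ι m + ι m)) + 2ℚ)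
      (∣⊤∣≡n n)))
    (trans (*-distribˡ-+ 2ℚ (sumOver S (h ∘ inj₁)) (sumOver ⊤ (h ∘ inj₂))) (cong (2ℚ * sumOver S (h ∘ inj₁) +_)
      (trans (cong (2ℚ *_) (trans (sumOver-⊤ (h ∘ inj₂)) Σy)) (coordinate-sum n))))
    (*-monoˡ-nonneg 0≤2 (bound S ⊤ (S≠∅ , (i , ∈⊤) , ⊆-antisym ⊆⊤ (λ _ → x∈p∪q⁺ {p = S} (inj₂ ∈⊤)) ,
      (λ (S≡⊤ , _) → S≢⊤ S≡⊤))))

-- For n = 2 the sum x₁ + x₂ is fixed at 4, so two x-coordinates do not serve. The pair x₁, y₂ does,
-- its bound 3 being the inequality of {1}|{2}.
tightPair-2 : TightPair 2
tightPair-2 = record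
  { c₁ = inj₁ zero ; c₂ = inj₂ (suc zero)
  ; ≥1₁ = λ h h∈H → halve-≤ (subst (2ℚ * 1ℚ ≤_)
    (((∀ x → 2ℚ * (x + (0ℚ + 0ℚ)) ≡ 2ℚ * x) ∋ solve-∀ ℚ-ring) (h (inj₁ zero)))
      (partial-sum-≥ (true ∷ false ∷ []) (zero , here) (λ ()) h h∈H))
  -- The bisubset [2]|{2} has bound 5, and x₁ + x₂ = 4.
  ; ≥1₂ = λ h (Σx , _ , bound) → ≤-by _
      (p≤q⇒0≤q-p (subst (λ t → ℤ.+ 5 / 1 ≤ t + (0ℚ + (h (inj₂ (suc zero)) + 0ℚ))) Σx
        (bound ⊤ (false ∷ true ∷ []) ((zero , here) , (suc zero , there here) , refl , λ ()))))
      (((∀ y → y ≡ 1ℚ + ((ℤ.+ 4 / 1 + (0ℚ + (y + 0ℚ))) - ℤ.+ 5 / 1)) ∋ solve-∀ ℚ-ring) (h (inj₂ (suc zero))))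
  ; ≥3 = λ h (_ , _ , bound) → subst (3ℚ ≤_)
      (((∀ x y → (x + (0ℚ + 0ℚ)) + (0ℚ + (y + 0ℚ)) ≡ x + y) ∋ solve-∀ ℚ-ring) (h (inj₁ zero)) (h (inj₂ (suc zero))))
      (bound (true ∷ false ∷ []) (false ∷ true ∷ []) ((zero , here) , (suc zero , there here) , refl , λ ()))
  ; h₁ = rankPoint up down (suc zero) ; h₂ = rankPoint up down zero
  ; h₁∈H = rankPoint∈Harmonic up down (suc zero) ; h₂∈H = rankPoint∈Harmonic up down zero
  ; h₁-c₁ = refl ; h₁-c₂ = refl ; h₂-c₂ = refl
  -- Its only crossing is the bar of `zero` before `suc zero`, which enters neither coordinate. The
  -- excess is 4 - 2 - 2 = 0, so k may coincide with the index of `c₂`.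
  ; b = zero ∷ zero ∷ suc zero ∷ [] ; k = suc zero
  ; bip = refl , refl , λ { zero _ → refl ; (suc zero) 1≢1 → ⊥-elim (1≢1 refl) }
  ; r-c₁ = refl ; r-c₂ = refl
  }
  where
  up down : Tournament 2
  up   = byOrder toℕ Fin.toℕ-injective
  down = reverse up

-- Two x-coordinates now form a proper subset, with bounds 1, 1 and 3 from `partial-sum-≥`. A third
-- index can play k, leaving the first two ranks unshifted.
tightPair-3+ : ∀ n → TightPair (3 ℕ.+ n)
tightPair-3+ n = record
  { c₁ = inj₁ zero ; c₂ = inj₁ (suc zero)
  ; ≥1₁ = λ h h∈H → halve-≤ (subst₂ _≤_ (size-of 1)
      (trans (cong (λ t → 2ℚ * (h (inj₁ zero) + (0ℚ + t))) (sumOver-⊥ (λ i → h (inj₁ (suc (suc i))))))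
        (((∀ x → 2ℚ * (x + (0ℚ + 0ℚ)) ≡ 2ℚ * x) ∋ solve-∀ ℚ-ring) (h (inj₁ zero))))
      (partial-sum-≥ (true ∷ false ∷ ⊥) (zero , here) (λ ()) h h∈H))
  ; ≥1₂ = λ h h∈H → halve-≤ (subst₂ _≤_ (size-of 1)
      (trans (cong (λ t → 2ℚ * (0ℚ + (h (inj₁ (suc zero)) + t))) (sumOver-⊥ (λ i → h (inj₁ (suc (suc i))))))
        (((∀ x → 2ℚ * (0ℚ + (x + 0ℚ)) ≡ 2ℚ * x) ∋ solve-∀ ℚ-ring) (h (inj₁ (suc zero)))))
      (partial-sum-≥ (false ∷ true ∷ ⊥) (suc zero , there here) (λ ()) h h∈H))
  ; ≥3 = λ h h∈H → halve-≤ (subst₂ _≤_ (size-of 2)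
      (trans (cong (λ t → 2ℚ * (h (inj₁ zero) + (h (inj₁ (suc zero)) + t))) (sumOver-⊥ (λ i → h (inj₁ (suc (suc i))))))
        (((∀ x y → 2ℚ * (x + (y + 0ℚ)) ≡ 2ℚ * (x + y)) ∋ solve-∀ ℚ-ring) (h (inj₁ zero)) (h (inj₁ (suc zero)))))
      (partial-sum-≥ (true ∷ true ∷ ⊥) (zero , here) (λ ()) h h∈H))
  ; h₁ = rankPoint up up third ; h₂ = rankPoint swapped up third
  ; h₁∈H = rankPoint∈Harmonic up up third ; h₂∈H = rankPoint∈Harmonic swapped up third
  ; h₁-c₁ = cong (λ t → (1ℚ + t) + 0ℚ) (Σ-zero {3 ℕ.+ n} (λ j → ⟦⟧-false (toℕ j ℕ.<? 0) λ ()))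
  ; h₁-c₂ = cong (λ t → (1ℚ + (1ℚ + t)) + 0ℚ) (Σ-zero {2 ℕ.+ n} (λ j → ⟦⟧-false (suc (toℕ j) ℕ.<? 1) λ { (s≤s ()) }))
  ; h₂-c₂ = cong (λ t → (1ℚ + t) + 0ℚ) (Σ-zero (λ j → ⟦⟧-false (σ j ℕ.<? 0) λ ()))
  ; b = proj₁ cone ; k = proj₁ (proj₂ cone) ; bip = proj₁ (proj₂ (proj₂ cone))
  ; r-c₁ = lowest (proj₂ (proj₂ (proj₂ cone))) zero refl
  ; r-c₂ = lowest (proj₂ (proj₂ (proj₂ cone))) (suc zero) refl
  }
  where
  third : Fin (3 ℕ.+ n)
  third = suc (suc zero)
  σ : Fin (3 ℕ.+ n) → ℕ
  σ zero          = 1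
  σ (suc zero)    = 0
  σ (suc (suc i)) = 2 ℕ.+ toℕ i
  σ-injective : ∀ {i j} → σ i ≡ σ j → i ≡ j
  σ-injective {zero}        {zero}        _  = refl
  σ-injective {suc zero}    {suc zero}    _  = refl
  σ-injective {zero}        {suc zero}    ()
  σ-injective {zero}        {suc (suc _)} ()
  σ-injective {suc (suc i)} {suc (suc j)} eq = cong (λ i → suc (suc i))
    (Fin.toℕ-injective (ℕ.suc-injective (ℕ.suc-injective eq)))
  up swapped : Tournament (3 ℕ.+ n)
  up      = byOrder toℕ Fin.toℕ-injective
  swapped = byOrder σ σ-injective
  size-of : ∀ m → ι (m ℕ.+ ∣ ⊥ {suc n} ∣) * ι (m ℕ.+ ∣ ⊥ {suc n} ∣) + ι (m ℕ.+ ∣ ⊥ {suc n} ∣) ≡ ι m * ι m + ι m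
  size-of m = cong (λ t → ι t * ι t + ι t) (trans (cong (m ℕ.+_) (∣⊥∣≡0 (suc n))) (ℕ.+-identityʳ m))
  -- The sum of the two chosen coordinates: sorting by it produces a suitable bipermutation for all
  -- n at once.
  ℓ : Coord (3 ℕ.+ n) → ℚ
  ℓ (inj₁ zero)          = 1ℚ
  ℓ (inj₁ (suc zero))    = 1ℚ
  ℓ (inj₁ (suc (suc _))) = 0ℚ
  ℓ (inj₂ _)             = 0ℚ
  cone : ∃[ b ] ∃[ k ] Σ (IsBipermutation (3 ℕ.+ n) b k) λ bip → Sorted (arrangement b k bip) k ℓ
  cone = sorted-bipermutation ℓ
  -- The index `third` shows m ≤ 0. Hence i, with key 1, differs from k and precedes every bar, all
  -- bars having key m.
  lowest : ∀ {A k} → Sorted A k ℓ → ∀ i → ℓ (inj₁ i) ≡ 1ℚ → Places.residual A k (inj₁ i) ≡ - (2ℚ * ι (3 ℕ.+ n) + 1ℚ)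
  lowest {A} {k} sorted i ℓi≡1 = trans
    (cong₂ (λ x d → 2ℚ * x - K + d * excess k)
      (Σ-zero (λ j → ⟦⟧-false (place (inj₂ j) ℕ.<? place (inj₁ i)) (uncrossed j))) (δ-≢ i≢k))
    (((∀ K e → 2ℚ * 0ℚ - K + 0ℚ * e ≡ - K) ∋ solve-∀ ℚ-ring) K (excess k))
    where
    open Places A
    open Sorted sorted
    K : ℚ
    K = 2ℚ * ι (3 ℕ.+ n) + 1ℚ
    1≰0 : ¬ 1ℚ ≤ 0ℚ
    1≰0 (*≤* (ℤ.+≤+ ()))
    i≢k : i ≢ k
    i≢k refl = 1≰0 (subst (_≤ 0ℚ) (trans (+-identityʳ (ℓ (inj₁ i))) ℓi≡1) (minimal third))
    uncrossed : ∀ j → ¬ place (inj₂ j) ℕ.< place (inj₁ i)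
    uncrossed j j̄<i = 1≰0 (≤-trans (subst₂ _≤_ (trans (key₁ i) ℓi≡1) (trans (key₂ j) (+-identityʳ m))
      (antitone (ℕ.<⇒≤ j̄<i) (place<size (inj₁ i)))) (minimal third))

theorem9p4 : ∀ (n : ℕ) → 2 ℕ.≤ n →
  MinkowskiQuotientIs (Bipermutahedron n) (Harmonic n) (ℤ.+ 2 / 1)
theorem9p4 n@(suc _) 2≤n =
  0≤2 , (_ , residuals n , decomposition n 2≤ιn) , quotient≤2 2≤ιn (tightPair n 2≤n)
  where
  2≤ιn : 2ℚ ≤ ι n
  2≤ιn = subst (2ℚ ≤_) (trans (sym (ι-+ 2 (n ℕ.∸ 2))) (cong ι (ℕ.m+[n∸m]≡n 2≤n)))
    (≤-by (ι (n ℕ.∸ 2)) (ι-nonneg (n ℕ.∸ 2)) refl)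
  tightPair : ∀ n → 2 ℕ.≤ n → TightPair n
  tightPair (suc zero)          (s≤s ())
  tightPair (suc (suc zero))    _ = tightPair-2
  tightPair (suc (suc (suc n))) _ = tightPair-3+ n
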